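{- Let $K_4$ be the complete $3$-graph on $4$ vertices and $F_{3,2}$ the $3$-graph on $\{1,\dots,5\}$ with edges $123,124,125,345$. Then \[\pi_{K_4}(\{F_{3,2}\})=\frac{3}{32}.\]
   Context: A $3$-graph is a pair $G=(V,E)$ with $E$ a set of $3$-element subsets of $V$. For a $3$-graph $H$ on $h$ vertices and a $3$-graph $G$ on $n\ge h$ vertices, $e_H(G)$ is the number of $h$-subsets of $V(G)$ inducing a subgraph isomorphic to $H$. For a family $\mathcal{F}$ of $3$-graphs, $G$ is $\mathcal{F}$-free if it contains no member of $\mathcal{F}$ as a (not necessarily induced) subgraph. $\mathrm{ex}_H(n,\mathcal{F})$ is the maximum of $e_H(G)$ over $\mathcal{F}$-free $G$ on $n$ vertices, and $\pi_H(\mathcal{F})=\lim_{n\to\infty}\mathrm{ex}_H(n,\mathcal{F})/\binom{n}{h}$ (the limit exists). -}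

module Defs where

open import Data.Nat using (ℕ; zero; suc; _≥_)
open import Data.Nat.Combinatorics using (_C_)
open import Data.Fin using (Fin; _<?_) renaming (zero to f0; suc to fs)
open import Data.Bool using (Bool; true; false; _∧_; if_then_else_)
open import Data.List using (List; []; _∷_; length; filter; concatMap; allFin)
open import Data.Integer using (+_)
open import Data.Rational using (ℚ; _/_; 0ℚ; ∣_∣; _-_; _<_; Positive)
open import Data.Product using (Σ; ∃; _×_; _,_)
open import Relation.Binary.PropositionalEquality using (_≡_; _≢_)
open import Relation.Nullary using (¬_)
open import Relation.Nullary.Decidable using (⌊_⌋)
open import Function.Definitions using (Injective)

-- A 3-graph on vertex set Fin n.  The edge {a,b,c} (a,b,c distinct) is
-- present iff E a b c ≡ true; E is required to be symmetric, so this only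
-- depends on the set {a,b,c}.  Values of E on non-distinct triples are ignored.
record Graph3 (n : ℕ) : Set where
  field
    E     : Fin n → Fin n → Fin n → Bool
    swap₁ : ∀ a b c → E a b c ≡ E b a c
    swap₂ : ∀ a b c → E a b c ≡ E a c b
open Graph3 public

-- F_{3,2} on vertices {0,...,4} (= {1,...,5} shifted): edges 012, 013, 014, 234
-- i.e. 123, 124, 125, 345.
v0 v1 v2 v3 v4 : Fin 5
v0 = f0
v1 = fs f0
v2 = fs (fs f0)
v3 = fs (fs (fs f0))
v4 = fs (fs (fs (fs f0)))

ContainsF32 : ∀ {n} → Graph3 n → Set
ContainsF32 {n} G = Σ (Fin 5 → Fin n) λ f → Injective _≡_ _≡_ f ×
  (E G (f v0) (f v1) (f v2) ≡ true) ×
  (E G (f v0) (f v1) (f v3) ≡ true) ×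
  (E G (f v0) (f v1) (f v4) ≡ true) ×
  (E G (f v2) (f v3) (f v4) ≡ true)

F32-free : ∀ {n} → Graph3 n → Set
F32-free G = ¬ ContainsF32 G

quads : (n : ℕ) → List (Fin n × Fin n × Fin n × Fin n)
quads n = concatMap (λ a → concatMap (λ b → concatMap (λ c → concatMap (λ d →
  if ⌊ a <? b ⌋ ∧ ⌊ b <? c ⌋ ∧ ⌊ c <? d ⌋ then (a , b , c , d) ∷ [] else [])
  (allFin n)) (allFin n)) (allFin n)) (allFin n)

isK4 : ∀ {n} → Graph3 n → Fin n × Fin n × Fin n × Fin n → Bool
isK4 G (a , b , c , d) = E G a b c ∧ E G a b d ∧ E G a c d ∧ E G b c d

eK4 : ∀ {n} → Graph3 n → ℕ
eK4 {n} G = length (filter (λ q → isK4 G q Data.Bool.≟ true) (quads n))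
  where import Data.Bool

IsEx : ℕ → ℕ → Set
IsEx n m = (Σ (Graph3 n) λ G → F32-free G × eK4 G ≡ m)
         × (∀ (G : Graph3 n) → F32-free G → eK4 G Data.Nat.≤ m)
  where import Data.Nat

-- m / binom(n,4) as a rational (set to 0 when binom(n,4) = 0, i.e. n < 4;
-- irrelevant for the limit)
density : ℕ → ℕ → ℚ
density n m with n C 4
... | zero  = 0ℚ
... | suc d = (+ m) / suc d

ExDensityLimit : ℚ → Set
ExDensityLimit L = ∀ (ε : ℚ) → Positive ε → ∃ λ N → ∀ n → n ≥ N → ∀ m →
  IsEx n m → ∣ density n m - L ∣ < ε

{-# OPTIONS --safe #-}
-- In an F₃,₂-free 3-graph on n vertices let κ be the number of ordered K₄s, d(abc) the number of x completing abc to a K₄,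
-- D(v) the number of ordered pairs xy with vxy an edge, and x(v) the number of ordered K₄s starting at v.
-- F₃,₂-freeness says that the neighbourhood of a pair contains no edge.  Given a K₄ with vertices a, b, c, e:
--   * a vertex completes at most one of its four triples, so 4 Σ d² ≤ n κ;
--   * for every x, y, at most two of axy, bxy, cxy, exy are edges, and none of them if x and y both complete
--     the same triple, so 2 Σ D(v) x(v) + 4 Σ d³ ≤ n² κ.
-- Cauchy–Schwarz gives x(v)² ≤ D(v) Σ_{bc} d(vbc)², which AM-GM linearises to
-- 288 n² x(v) ≤ 256 D(v) x(v) + 384 n Σ_{bc} d(vbc)² + 9 n⁵; together with 16 d³ + n² d ≥ 8 n d² this yields
-- 32 κ ≤ 3 n⁴.  All of these are asymptotic equalities for the balanced complete 4-partite 3-graph (d = n/4 on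
-- edges, D = 3n²/8, x = 3n³/32), which also gives the lower bound.
module Submission where

open import Defs
open import Data.Nat using (ℕ)
open import Data.Integer using (+_)
open import Data.Rational using (ℚ; _/_)
open import Data.Product using (∃; _×_)

open import Data.Nat.Properties hiding (_≟_; _<?_)
open import Algebra.Properties.Semiring.Sum +-*-semiring using (sum; sum-cong-≗; ∑-comm; ∑-distrib-+; *-distribˡ-sum; *-distribʳ-sum)
open import Data.Bool using (Bool; true; false; _∧_; T; not; if_then_else_) renaming (_≟_ to _≟ᵇ_)
open import Data.Bool.Properties using (T-∧; T-≡; ∧-comm; ∧-assoc; ∧-idem)
open import Data.Empty using (⊥-elim)
open import Data.Fin using (Fin; toℕ; _≟_) renaming (zero to f0; suc to fs; _<_ to _<ᶠ_; _<?_ to _<ᶠ?_)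
open import Data.Fin.Properties using (injective⇒≤)
open import Data.Integer using (_⊖_)
import Data.Integer as ℤ
import Data.Integer.Properties as ℤ
open import Data.List as List using (List; []; _∷_; _++_; length; filter; map; concatMap; cartesianProductWith; allFin)
open import Data.List.Extrema ≤-totalOrder using (argmax; argmax-all; f[xs]≤f[argmax])
open import Data.List.Membership.Propositional using (_∈_; lose)
open import Data.List.Membership.Propositional.Properties using (∈-cartesianProductWith⁺; ∈-filter⁺; ∈-map⁺; ∈-allFin)
open import Data.List.Properties using (filter-++; length-++)
open import Data.List.Relation.Unary.All using () renaming (lookup to All-lookup)
open import Data.List.Relation.Unary.All.Properties using (all-filter)
open import Data.List.Relation.Unary.Any using (here; there; any?; satisfied)
open import Data.Nat using (zero; suc; _+_; _*_; _≤_; _<_; _<ᵇ_; _<?_; z≤n; s≤s; NonZero)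
open import Data.Nat.Combinatorics using (_C_; nCk+nC[k+1]≡[n+1]C[k+1]; nC1≡n)
open import Data.Nat.DivMod using (_%_; m≡m%n+[m/n]*n; m%n<n) renaming (_/_ to _div_)
open import Data.Nat.Tactic.RingSolver using (solve-∀)
open import Data.Product using (_,_; proj₁; proj₂)
import Data.Rational as ℚ
open import Data.Rational using (mkℚ; toℚᵘ)
import Data.Rational.Properties as ℚ
import Data.Rational.Unnormalised as ℚᵘ
open import Data.Rational.Unnormalised using (mkℚᵘ)
import Data.Rational.Unnormalised.Properties as ℚᵘ
open import Data.Sum using (inj₁; inj₂)
open import Data.Unit using (tt)
open import Data.Vec using (Vec; []; _∷_; lookup; tabulate)
open import Data.Vec.Properties using (lookup∘tabulate)
open import Data.Vec.Relation.Unary.All using ([]; _∷_)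
open import Data.Vec.Relation.Unary.AllPairs using ([]; _∷_; allPairs?)
open import Data.Vec.Relation.Unary.Unique.Propositional using (Unique)
open import Data.Vec.Relation.Unary.Unique.Propositional.Properties using (lookup-injective; tabulate⁺)
open import Function using (_∘_; id; Equivalence)
import Relation.Binary.Reasoning.Setoid as SetoidReasoning
open import Relation.Binary.PropositionalEquality using (_≡_; _≢_; refl; sym; trans; cong; cong₂; subst; subst₂; module ≡-Reasoning)
open import Relation.Nullary using (¬_; Dec; contradiction; yes; no)
open import Relation.Nullary.Decidable using (⌊_⌋; toWitness; fromWitness; ¬?; _×-dec_; map′)
open import Relation.Unary using (Decidable)


-- Polynomial inequalities over the natural numbers.

2ab≤a²+b² : ∀ a b → 2 * (a * b) ≤ a * a + b * b
2ab≤a²+b² a b with ≤-total a b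
... | inj₁ a≤b with m≤n⇒∃[o]m+o≡n a≤b
-- With the larger number written as the smaller plus `k`, the two sides differ by exactly k².
...   | k , refl = m+n≤o⇒m≤o _ (≤-reflexive (gap a k))
  where
  gap : ∀ a k → 2 * (a * (a + k)) + k * k ≡ a * a + (a + k) * (a + k)
  gap = solve-∀
2ab≤a²+b² a b | inj₂ b≤a with m≤n⇒∃[o]m+o≡n b≤a
...   | k , refl = m+n≤o⇒m≤o _ (≤-reflexive (gap b k))
  where
  gap : ∀ b k → 2 * ((b + k) * b) + k * k ≡ (b + k) * (b + k) + b * b
  gap = solve-∀

private
  AM-GM : ℕ → ℕ → ℕ → Set
  AM-GM a b c = 3 * (a * b * c) ≤ a * a * b + b * b * c + c * c * a

  rotate : ∀ a b c → AM-GM b c a → AM-GM a b c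
  rotate a b c p = begin
    3 * (a * b * c)                         ≡⟨ rotateˡ a b c ⟩
    3 * (b * c * a)                         ≤⟨ p ⟩
    b * b * c + c * c * a + a * a * b       ≡⟨ rotateʳ a b c ⟩
    a * a * b + b * b * c + c * c * a       ∎
    where
    open ≤-Reasoning
    rotateˡ : ∀ a b c → 3 * (a * b * c) ≡ 3 * (b * c * a)
    rotateˡ = solve-∀
    rotateʳ : ∀ a b c → b * b * c + c * c * a + a * a * b ≡ a * a * b + b * b * c + c * c * a
    rotateʳ = solve-∀

  -- For a = c + p and b = c + r the right side exceeds the left by c(p² - pr + r²) + p²r. Adding
  -- c·p·r to both sides avoids the subtraction, and pr ≤ p² + r² does the rest.
  c-least : ∀ a b c → c ≤ a → c ≤ b → AM-GM a b c
  c-least a b c c≤a c≤b with m≤n⇒∃[o]m+o≡n c≤a | m≤n⇒∃[o]m+o≡n c≤b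
  ... | p , refl | r , refl = +-cancelʳ-≤ (c * (p * r)) _ _ (begin
      3 * ((c + p) * (c + r) * c) + c * (p * r)
        ≤⟨ +-monoʳ-≤ (3 * ((c + p) * (c + r) * c)) (*-monoʳ-≤ c (≤-trans (m≤m+n (p * r) _) (2ab≤a²+b² p r))) ⟩
      3 * ((c + p) * (c + r) * c) + c * (p * p + r * r)
        ≤⟨ +-monoʳ-≤ (3 * ((c + p) * (c + r) * c)) (m≤m+n _ _) ⟩
      3 * ((c + p) * (c + r) * c) + (c * (p * p + r * r) + p * p * r)
        ≡⟨ expand c p r ⟨
      _ ∎)
    where
    open ≤-Reasoning
    expand : ∀ c p r → (c + p) * (c + p) * (c + r) + (c + r) * (c + r) * c + c * c * (c + p) + c * (p * r)
                     ≡ 3 * ((c + p) * (c + r) * c) + (c * (p * p + r * r) + p * p * r)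
    expand = solve-∀

-- This is AM-GM for a²b, b²c and c²a, whose product is (abc)³. The claim is invariant under cyclic
-- shifts but not under transpositions, so only the position of a least variable is normalised.
cyclic-AM-GM : ∀ a b c → 3 * (a * b * c) ≤ a * a * b + b * b * c + c * c * a
cyclic-AM-GM a b c with ≤-total a b | ≤-total b c | ≤-total c a
... | inj₁ a≤b | _        | inj₂ a≤c = rotate a b c (c-least b c a a≤b a≤c)
... | inj₁ a≤b | inj₁ b≤c | inj₁ c≤a = c-least a b c c≤a (≤-trans c≤a a≤b)
... | inj₁ _   | inj₂ c≤b | inj₁ c≤a = c-least a b c c≤a c≤b
... | inj₂ b≤a | inj₁ b≤c | _        = rotate a b c (rotate b c a (c-least c a b b≤c b≤a))
... | inj₂ b≤a | inj₂ c≤b | _        = c-least a b c (≤-trans c≤b b≤a) c≤b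

square-cancel-≤ : ∀ {m n} → m * m ≤ n * n → m ≤ n
square-cancel-≤ {m} {n} p with ≤-<-connex m n
... | inj₁ m≤n = m≤n
... | inj₂ n<m = contradiction p (<⇒≱ (*-mono-< n<m n<m))

-- Cauchy-Schwarz and iterated finite sums.

sum-mono : ∀ {n} {f g : Fin n → ℕ} → (∀ i → f i ≤ g i) → sum f ≤ sum g
sum-mono {zero}  p = z≤n
sum-mono {suc n} p = +-mono-≤ (p f0) (sum-mono (p ∘ fs))

sum-const : ∀ n c → sum {n} (λ _ → c) ≡ n * c
sum-const zero    c = refl
sum-const (suc n) c = cong (λ t → c + t) (sum-const n c)

-- Cauchy-Schwarz without square roots: q and d are the squares of the usual two sequences.
-- Hypothesis and conclusion have the same shape, so the lemma can be applied again to double sums.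
sum-Cauchy : ∀ {n} (x q d : Fin n → ℕ) → (∀ i → x i * x i ≤ q i * d i) → sum x * sum x ≤ sum q * sum d
sum-Cauchy {zero}  x q d p = z≤n
sum-Cauchy {suc n} x q d p = begin
  (x₀ + X) * (x₀ + X)                           ≡⟨ expandˡ x₀ X ⟩
  x₀ * x₀ + X * X + 2 * (x₀ * X)                ≤⟨ +-mono-≤ (+-mono-≤ (p f0) ih) cross ⟩
  q₀ * d₀ + Q * D + (q₀ * D + Q * d₀)           ≡⟨ expandʳ q₀ Q d₀ D ⟩
  (q₀ + Q) * (d₀ + D)                           ∎
  where
  open ≤-Reasoning
  x₀ = x f0
  q₀ = q f0
  d₀ = d f0
  X = sum (x ∘ fs)
  Q = sum (q ∘ fs)
  D = sum (d ∘ fs)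
  ih : X * X ≤ Q * D
  ih = sum-Cauchy (x ∘ fs) (q ∘ fs) (d ∘ fs) (p ∘ fs)
  expandˡ : ∀ x X → (x + X) * (x + X) ≡ x * x + X * X + 2 * (x * X)
  expandˡ = solve-∀
  expandʳ : ∀ q Q d D → q * d + Q * D + (q * D + Q * d) ≡ (q + Q) * (d + D)
  expandʳ = solve-∀
  square-2 : ∀ x X → 2 * (x * X) * (2 * (x * X)) ≡ 4 * (x * x * (X * X))
  square-2 = solve-∀
  regroup : ∀ q d Q D → 4 * (q * d * (Q * D)) ≡ 2 * (q * D * (Q * d)) + 2 * (q * D * (Q * d))
  regroup = solve-∀
  square-+ : ∀ u v → u * u + v * v + 2 * (u * v) ≡ (u + v) * (u + v)
  square-+ = solve-∀
  cross : 2 * (x₀ * X) ≤ q₀ * D + Q * d₀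
  -- With u = q₀D and v = Qd₀ the hypotheses bound the square of the left side by 4uv, which is at
  -- most (u + v)².
  cross = square-cancel-≤ (begin
    2 * (x₀ * X) * (2 * (x₀ * X))                         ≡⟨ square-2 x₀ X ⟩
    4 * (x₀ * x₀ * (X * X))                               ≤⟨ *-monoʳ-≤ 4 (*-mono-≤ (p f0) ih) ⟩
    4 * (q₀ * d₀ * (Q * D))                               ≡⟨ regroup q₀ d₀ Q D ⟩
    2 * (u * v) + 2 * (u * v)                             ≤⟨ +-monoˡ-≤ (2 * (u * v)) (2ab≤a²+b² u v) ⟩
    u * u + v * v + 2 * (u * v)                           ≡⟨ square-+ u v ⟩
    (u + v) * (u + v)                                     ∎)
    where
    u = q₀ * D
    v = Q * d₀

sum₂ : ∀ {n} → (Fin n → Fin n → ℕ) → ℕ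
sum₂ f = sum λ a → sum (f a)

module _ {n : ℕ} where

  sum₂-mono : {f g : Fin n → Fin n → ℕ} → (∀ a b → f a b ≤ g a b) → sum₂ f ≤ sum₂ g
  sum₂-mono p = sum-mono λ a → sum-mono (p a)

  sum₂-+ : (f g : Fin n → Fin n → ℕ) → sum₂ (λ a b → f a b + g a b) ≡ sum₂ f + sum₂ g
  sum₂-+ f g = trans (sum-cong-≗ λ a → ∑-distrib-+ (f a) (g a)) (∑-distrib-+ (λ a → sum (f a)) (λ a → sum (g a)))

  sum₂-*ˡ : ∀ x (f : Fin n → Fin n → ℕ) → sum₂ (λ a b → x * f a b) ≡ x * sum₂ f
  sum₂-*ˡ x f = sym (trans (*-distribˡ-sum x (λ a → sum (f a))) (sum-cong-≗ λ a → *-distribˡ-sum x (f a)))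

  sum-*-sum : (f g : Fin n → ℕ) → sum f * sum g ≡ sum₂ λ a b → f a * g b
  sum-*-sum f g = trans (*-distribʳ-sum (sum g) f) (sum-cong-≗ λ a → *-distribˡ-sum (f a) g)

sum₃ : ∀ {n} → (Fin n → Fin n → Fin n → ℕ) → ℕ
sum₃ f = sum λ a → sum λ b → sum λ c → f a b c

sum₄ : ∀ {n} → (Fin n → Fin n → Fin n → Fin n → ℕ) → ℕ
sum₄ f = sum λ a → sum₃ (f a)

module _ {n : ℕ} where

  sum₃-cong : {f g : Fin n → Fin n → Fin n → ℕ} → (∀ a b c → f a b c ≡ g a b c) → sum₃ f ≡ sum₃ g
  sum₃-cong p = sum-cong-≗ λ a → sum-cong-≗ λ b → sum-cong-≗ (p a b)

  sum₃-mono : {f g : Fin n → Fin n → Fin n → ℕ} → (∀ a b c → f a b c ≤ g a b c) → sum₃ f ≤ sum₃ g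
  sum₃-mono p = sum-mono λ a → sum-mono λ b → sum-mono (p a b)

  sum₃-+ : (f g : Fin n → Fin n → Fin n → ℕ) → sum₃ (λ a b c → f a b c + g a b c) ≡ sum₃ f + sum₃ g
  sum₃-+ f g = trans
    (sum-cong-≗ λ a → trans (sum-cong-≗ λ b → ∑-distrib-+ (f a b) (g a b))
                            (∑-distrib-+ (λ b → sum (f a b)) (λ b → sum (g a b))))
    (∑-distrib-+ (λ a → sum λ b → sum (f a b)) (λ a → sum λ b → sum (g a b)))

  sum₃-*ˡ : ∀ x (f : Fin n → Fin n → Fin n → ℕ) → sum₃ (λ a b c → x * f a b c) ≡ x * sum₃ f
  sum₃-*ˡ x f = sym (trans (*-distribˡ-sum x (λ a → sum λ b → sum (f a b)))
    (sum-cong-≗ λ a → trans (*-distribˡ-sum x (λ b → sum (f a b)))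
      (sum-cong-≗ λ b → *-distribˡ-sum x (f a b))))

module _ {n : ℕ} {f g : Fin n → Fin n → Fin n → Fin n → ℕ} where

  sum₄-cong : (∀ a b c d → f a b c d ≡ g a b c d) → sum₄ f ≡ sum₄ g
  sum₄-cong p = sum-cong-≗ λ a → sum₃-cong (p a)

  sum₄-mono : (∀ a b c d → f a b c d ≤ g a b c d) → sum₄ f ≤ sum₄ g
  sum₄-mono p = sum-mono λ a → sum₃-mono (p a)

module _ {n : ℕ} (f : Fin n → Fin n → Fin n → Fin n → ℕ) where

  sum₄-+ : (g : Fin n → Fin n → Fin n → Fin n → ℕ) → sum₄ (λ a b c d → f a b c d + g a b c d) ≡ sum₄ f + sum₄ g
  sum₄-+ g = trans (sum-cong-≗ λ a → sum₃-+ (f a) (g a)) (∑-distrib-+ (λ a → sum₃ (f a)) (λ a → sum₃ (g a)))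

  sum₄-*ˡ : ∀ x → sum₄ (λ a b c d → x * f a b c d) ≡ x * sum₄ f
  sum₄-*ˡ x = sym (trans (*-distribˡ-sum x (λ a → sum₃ (f a))) (sum-cong-≗ λ a → sym (sum₃-*ˡ x (f a))))

  sum₄-swap₁ : sum₄ f ≡ sum₄ λ a b c d → f b a c d
  sum₄-swap₁ = ∑-comm λ a b → sum λ c → sum λ d → f a b c d

  sum₄-swap₂ : sum₄ f ≡ sum₄ λ a b c d → f a c b d
  sum₄-swap₂ = sum-cong-≗ λ a → ∑-comm λ b c → sum λ d → f a b c d

  sum₄-swap₃ : sum₄ f ≡ sum₄ λ a b c d → f a b d c
  sum₄-swap₃ = sum-cong-≗ λ a → sum-cong-≗ λ b → ∑-comm (f a b)

-- K₄s in an F₃,₂-avoiding 3-graph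

⟦_⟧ : Bool → ℕ
⟦ true ⟧  = 1
⟦ false ⟧ = 0

⟦∧⟧ : ∀ p q → ⟦ p ∧ q ⟧ ≡ ⟦ p ⟧ * ⟦ q ⟧
⟦∧⟧ true  q = sym (+-identityʳ ⟦ q ⟧)
⟦∧⟧ false q = refl

¬T⇒0 : ∀ p → ¬ T p → ⟦ p ⟧ ≡ 0
¬T⇒0 true  ¬p = ⊥-elim (¬p tt)
¬T⇒0 false ¬p = refl

⟦⟧≤1 : ∀ p → ⟦ p ⟧ ≤ 1
⟦⟧≤1 true  = s≤s z≤n
⟦⟧≤1 false = z≤n

count≤1 : ∀ p q r s → ¬ (T p × T q) → ¬ (T p × T r) → ¬ (T p × T s) →
          ¬ (T q × T r) → ¬ (T q × T s) → ¬ (T r × T s) →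
          ⟦ p ⟧ + ⟦ q ⟧ + ⟦ r ⟧ + ⟦ s ⟧ ≤ 1
count≤1 true  q r s pq pr ps _ _ _
  rewrite ¬T⇒0 q (pq ∘ (tt ,_)) | ¬T⇒0 r (pr ∘ (tt ,_)) | ¬T⇒0 s (ps ∘ (tt ,_)) = ≤-refl
count≤1 false true r s _ _ _ qr qs _
  rewrite ¬T⇒0 r (qr ∘ (tt ,_)) | ¬T⇒0 s (qs ∘ (tt ,_)) = ≤-refl
count≤1 false false true s _ _ _ _ _ rs rewrite ¬T⇒0 s (rs ∘ (tt ,_)) = ≤-refl
count≤1 false false false s _ _ _ _ _ _ = ⟦⟧≤1 s

count≤2 : ∀ p q r s → ¬ (T p × T q × T r) → ¬ (T p × T q × T s) →
          ¬ (T p × T r × T s) → ¬ (T q × T r × T s) →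
          ⟦ p ⟧ + ⟦ q ⟧ + ⟦ r ⟧ + ⟦ s ⟧ ≤ 2
count≤2 true q r s pqr pqs prs _ = s≤s (count≤1 false q r s proj₁ proj₁ proj₁
  (λ (q , r) → pqr (tt , q , r)) (λ (q , s) → pqs (tt , q , s)) (λ (r , s) → prs (tt , r , s)))
count≤2 false true  r s _ _ _ qrs = s≤s (count≤1 false false r s proj₁ proj₁ proj₁ proj₁ proj₁
  (λ (r , s) → qrs (tt , r , s)))
count≤2 false false r s _ _ _ _   = +-mono-≤ (⟦⟧≤1 r) (⟦⟧≤1 s)

module _ {n : ℕ} (edge : Fin n → Fin n → Fin n → Bool) where

  K₄ : Fin n → Fin n → Fin n → Fin n → Bool
  K₄ a b c d = edge a b c ∧ edge a b d ∧ edge a c d ∧ edge b c d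

  completions : Fin n → Fin n → Fin n → ℕ
  completions a b c = sum λ x → ⟦ K₄ a b c x ⟧

  degree : Fin n → ℕ
  degree v = sum₂ λ x y → ⟦ edge v x y ⟧

-- `no-F₃₂` says that the neighbourhood of a pair spans no edge. It ranges over all vertices,
-- repeated or not: in `loopless` every edge has three distinct vertices, so the four edges always
-- meet in five distinct vertices.
record F₃₂-Avoiding (n : ℕ) : Set where
  field
    edge       : Fin n → Fin n → Fin n → Bool
    edge-swap₁ : ∀ a b c → edge a b c ≡ edge b a c
    edge-swap₂ : ∀ a b c → edge a b c ≡ edge a c b
    no-F₃₂     : ∀ u v x y z → T (edge u v x) → T (edge u v y) → T (edge u v z) → ¬ T (edge x y z)

  private
    K = K₄ edge
    d = completions edge
    D = degree edge

  T-swap₁ : ∀ {a b c} → T (edge a b c) → T (edge b a c)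
  T-swap₁ {a} {b} {c} = subst T (edge-swap₁ a b c)

  T-swap₂ : ∀ {a b c} → T (edge a b c) → T (edge a c b)
  T-swap₂ {a} {b} {c} = subst T (edge-swap₂ a b c)

  rot : ∀ {a b c} → T (edge a b c) → T (edge b c a)
  rot p = T-swap₂ (T-swap₁ p)

  K₄-swap₁ : ∀ a b c d → K a b c d ≡ K b a c d
  K₄-swap₁ a b c d rewrite edge-swap₁ a b c | edge-swap₁ a b d
    with edge b a c | edge b a d | edge a c d | edge b c d
  ... | true  | true  | true  | true  = refl
  ... | true  | true  | true  | false = refl
  ... | true  | true  | false | true  = refl
  ... | true  | true  | false | false = refl
  ... | true  | false | _     | _     = refl
  ... | false | _     | _     | _     = refl

  K₄-swap₂ : ∀ a b c d → K a b c d ≡ K a c b d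
  K₄-swap₂ a b c d rewrite edge-swap₂ a b c | edge-swap₁ b c d
    with edge a c b | edge a b d | edge a c d | edge c b d
  ... | true  | true  | true  | _ = refl
  ... | true  | true  | false | _ = refl
  ... | true  | false | true  | _ = refl
  ... | true  | false | false | _ = refl
  ... | false | _     | _     | _ = refl

  K₄-swap₃ : ∀ a b c d → K a b c d ≡ K a b d c
  K₄-swap₃ a b c d rewrite edge-swap₂ a c d | edge-swap₂ b c d
    with edge a b c | edge a b d | edge a d c | edge b d c
  ... | true  | true  | _ | _ = refl
  ... | true  | false | _ | _ = refl
  ... | false | true  | _ | _ = refl
  ... | false | false | _ | _ = refl

  K₄-edges : ∀ a b c d → T (K a b c d) → T (edge a b c) × T (edge a b d) × T (edge a c d) × T (edge b c d)
  K₄-edges a b c d k with Equivalence.to (T-∧ {edge a b c}) k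
  ... | abc , k′ with Equivalence.to (T-∧ {edge a b d}) k′
  ...   | abd , k″ = abc , abd , Equivalence.to (T-∧ {edge a c d}) k″

  K₄-link : ∀ a b c x → T (K a b c x) → T (edge a b x) × T (edge a c x) × T (edge b c x)
  K₄-link a b c x k = proj₂ (K₄-edges a b c x k)

  -- Two triples of the K₄ share a vertex. If x completes both, that vertex and x form a pair whose
  -- neighbourhood contains the other three vertices of the K₄, which span an edge.
  completions-disjoint : ∀ a b c d → T (K a b c d) → ∀ x →
    ⟦ K a b c x ⟧ + ⟦ K a b d x ⟧ + ⟦ K a c d x ⟧ + ⟦ K b c d x ⟧ ≤ 1
  completions-disjoint a b c d k x with K₄-edges a b c d k
  ... | abc , abd , acd , bcd = count≤1 (K a b c x) (K a b d x) (K a c d x) (K b c d x)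
    (λ (p , q) → let (abx , acx , _) = K₄-link a b c x p ; (_ , adx , _) = K₄-link a b d x q in star-a abx acx adx)
    (λ (p , q) → let (abx , acx , _) = K₄-link a b c x p ; (_ , adx , _) = K₄-link a c d x q in star-a abx acx adx)
    (λ (p , q) → let (abx , _ , bcx) = K₄-link a b c x p ; (_ , bdx , _) = K₄-link b c d x q in star-b abx bcx bdx)
    (λ (p , q) → let (abx , adx , _) = K₄-link a b d x p ; (acx , _ , _) = K₄-link a c d x q in star-a abx acx adx)
    (λ (p , q) → let (abx , _ , bdx) = K₄-link a b d x p ; (bcx , _ , _) = K₄-link b c d x q in star-b abx bcx bdx)
    (λ (p , q) → let (acx , _ , cdx) = K₄-link a c d x p ; (bcx , _ , _) = K₄-link b c d x q in star-c acx bcx cdx)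
    where
    star-a : T (edge a b x) → T (edge a c x) → ¬ T (edge a d x)
    star-a p q r = no-F₃₂ a x b c d (T-swap₂ p) (T-swap₂ q) (T-swap₂ r) bcd
    star-b : T (edge a b x) → T (edge b c x) → ¬ T (edge b d x)
    star-b p q r = no-F₃₂ b x a c d (rot p) (T-swap₂ q) (T-swap₂ r) acd
    star-c : T (edge a c x) → T (edge b c x) → ¬ T (edge c d x)
    star-c p q r = no-F₃₂ c x a b d (rot p) (rot q) (T-swap₂ r) abd

  -- Three of the four edges would put a triple of the K₄, which is an edge, into the neighbourhood
  -- of xy.
  codegree≤2 : ∀ a b c d → T (K a b c d) → ∀ x y →
    ⟦ edge a x y ⟧ + ⟦ edge b x y ⟧ + ⟦ edge c x y ⟧ + ⟦ edge d x y ⟧ ≤ 2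
  codegree≤2 a b c d k x y with K₄-edges a b c d k
  ... | abc , abd , acd , bcd = count≤2 (edge a x y) (edge b x y) (edge c x y) (edge d x y)
    (λ (p , q , r) → no-F₃₂ x y a b c (rot p) (rot q) (rot r) abc)
    (λ (p , q , r) → no-F₃₂ x y a b d (rot p) (rot q) (rot r) abd)
    (λ (p , q , r) → no-F₃₂ x y a c d (rot p) (rot q) (rot r) acd)
    (λ (p , q , r) → no-F₃₂ x y b c d (rot p) (rot q) (rot r) bcd)

  -- The neighbourhood of bc contains a, x and y, so axy is not an edge, and likewise for b and c.
  -- The neighbourhood of ab contains d, x and y, which excludes dxy.
  completion-pair : ∀ a b c d x y → T (K a b c d) → T (K a b c x) → T (K a b c y) →
    ¬ T (edge a x y) × ¬ T (edge b x y) × ¬ T (edge c x y) × ¬ T (edge d x y)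
  completion-pair a b c d x y k p q with K₄-edges a b c d k | K₄-link a b c x p | K₄-link a b c y q
  ... | abc , abd , _ | abx , acx , bcx | aby , acy , bcy =
      no-F₃₂ b c a x y (rot abc) bcx bcy
    , no-F₃₂ a c b x y (T-swap₂ abc) acx acy
    , no-F₃₂ a b c x y abc abx aby
    , no-F₃₂ a b d x y abd abx aby

  -- Either some triple is completed by both x and y, and then all edge terms vanish while only one
  -- product survives, or no product survives and `codegree≤2` applies. The weight 2 makes both
  -- cases reach the same bound.
  K₄-pair-bound : ∀ a b c d → T (K a b c d) → ∀ x y →
    (⟦ edge a x y ⟧ + ⟦ edge b x y ⟧ + ⟦ edge c x y ⟧ + ⟦ edge d x y ⟧)
    + 2 * (⟦ K a b c x ⟧ * ⟦ K a b c y ⟧ + ⟦ K a b d x ⟧ * ⟦ K a b d y ⟧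
           + ⟦ K a c d x ⟧ * ⟦ K a c d y ⟧ + ⟦ K b c d x ⟧ * ⟦ K b c d y ⟧) ≤ 2
  K₄-pair-bound a b c d k x y
    -- Products of indicators become indicators of conjunctions, so that `exclusive` can split on
    -- four Booleans.
    rewrite sym (⟦∧⟧ (K a b c x) (K a b c y)) | sym (⟦∧⟧ (K a b d x) (K a b d y))
          | sym (⟦∧⟧ (K a c d x) (K a c d y)) | sym (⟦∧⟧ (K b c d x) (K b c d y)) =
    exclusive (K a b c x ∧ K a b c y) (K a b d x ∧ K a b d y) (K a c d x ∧ K a c d y) (K b c d x ∧ K b c d y)
      (kills a b c d id k)
      (kills a b d c (λ (a , b , d , c) → a , b , c , d) (subst T (K₄-swap₃ a b c d) k))
      (kills a c d b (λ (a , c , d , b) → a , b , c , d) (subst T (trans (K₄-swap₂ a b c d) (K₄-swap₃ a c b d)) k))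
      (kills b c d a (λ (b , c , d , a) → a , b , c , d)
        (subst T (trans (K₄-swap₁ a b c d) (trans (K₄-swap₂ b a c d) (K₄-swap₃ b c a d))) k))
      m≤1
    where
    edges≡0 = ¬ T (edge a x y) × ¬ T (edge b x y) × ¬ T (edge c x y) × ¬ T (edge d x y)

    -- Here uvw is the completed triple and t the fourth vertex of the K₄; `reorder` returns the
    -- four non-edges to the order a, b, c, d.
    kills : ∀ u v w t → (¬ T (edge u x y) × ¬ T (edge v x y) × ¬ T (edge w x y) × ¬ T (edge t x y) → edges≡0) →
            T (K u v w t) → T (K u v w x ∧ K u v w y) → edges≡0
    kills u v w t reorder k′ pq with Equivalence.to (T-∧ {K u v w x}) pq
    ... | p , q = reorder (completion-pair u v w t x y k′ p q)

    dead : ∀ m → m ≤ 1 → edges≡0 →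
           (⟦ edge a x y ⟧ + ⟦ edge b x y ⟧ + ⟦ edge c x y ⟧ + ⟦ edge d x y ⟧) + 2 * m ≤ 2
    dead m m≤1 (¬a , ¬b , ¬c , ¬d)
      rewrite ¬T⇒0 (edge a x y) ¬a | ¬T⇒0 (edge b x y) ¬b | ¬T⇒0 (edge c x y) ¬c | ¬T⇒0 (edge d x y) ¬d
      = *-monoʳ-≤ 2 m≤1

    m≤1 : ⟦ K a b c x ∧ K a b c y ⟧ + ⟦ K a b d x ∧ K a b d y ⟧ + ⟦ K a c d x ∧ K a c d y ⟧ + ⟦ K b c d x ∧ K b c d y ⟧ ≤ 1
    m≤1 = ≤-trans (+-mono-≤ (+-mono-≤ (+-mono-≤ (∧≤ (K a b c x) _) (∧≤ (K a b d x) _)) (∧≤ (K a c d x) _)) (∧≤ (K b c d x) _))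
                  (completions-disjoint a b c d k x)
      where
      ∧≤ : ∀ p q → ⟦ p ∧ q ⟧ ≤ ⟦ p ⟧
      ∧≤ true  q = ⟦⟧≤1 q
      ∧≤ false q = z≤n

    exclusive : ∀ p q r s → (T p → edges≡0) → (T q → edges≡0) → (T r → edges≡0) → (T s → edges≡0) →
      ⟦ p ⟧ + ⟦ q ⟧ + ⟦ r ⟧ + ⟦ s ⟧ ≤ 1 →
      (⟦ edge a x y ⟧ + ⟦ edge b x y ⟧ + ⟦ edge c x y ⟧ + ⟦ edge d x y ⟧)
      + 2 * (⟦ p ⟧ + ⟦ q ⟧ + ⟦ r ⟧ + ⟦ s ⟧) ≤ 2
    exclusive true  _     _     _     f _ _ _ m = dead _ m (f tt)
    exclusive false true  _     _     _ f _ _ m = dead _ m (f tt)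
    exclusive false false true  _     _ _ f _ m = dead _ m (f tt)
    exclusive false false false true  _ _ _ f m = dead _ m (f tt)
    exclusive false false false false _ _ _ _ _ =
      ≤-trans (≤-reflexive (+-identityʳ _)) (codegree≤2 a b c d k x y)

-- The upper bound on ordered K₄s, by summing the local inequalities.

⟦⟧-guard : ∀ p {m n} → (T p → m ≤ n) → ⟦ p ⟧ * m ≤ ⟦ p ⟧ * n
⟦⟧-guard true  m≤n = *-monoʳ-≤ 1 (m≤n tt)
⟦⟧-guard false _   = z≤n

-- After x² is replaced by qD, every term of the cyclic AM-GM inequality for 8nD, 32x and 3n³ is a
-- multiple of 8n²D, and cancelling this factor gives the claim. If D = 0 the factor cannot be
-- cancelled, but then x² ≤ 0 forces x = 0.
vertex-AM-GM : ∀ n D x q → x * x ≤ q * D →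
               288 * (n * n * x) ≤ 256 * (D * x) + 384 * (n * q) + 9 * (n * n * n * n * n)
vertex-AM-GM zero      D       x       q x²≤qD = z≤n
vertex-AM-GM n@(suc _) zero    zero    q x²≤qD = ≤-trans (≤-reflexive (cong (288 *_) (*-zeroʳ (n * n)))) z≤n
vertex-AM-GM n@(suc _) zero    (suc _) q x²≤qD with () ← ≤-trans x²≤qD (≤-reflexive (*-zeroʳ q))
vertex-AM-GM n@(suc _) D@(suc _) x q x²≤qD = *-cancelˡ-≤ (8 * n * n * D) (begin
  8 * n * n * D * (288 * (n * n * x))
    ≡⟨ factorˡ n D x ⟩
  3 * (8 * n * D * (32 * x) * (3 * n * n * n))
    -- All three arguments equal 3n³ in the extremal graph.
    ≤⟨ cyclic-AM-GM (8 * n * D) (32 * x) (3 * n * n * n) ⟩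
  8 * n * D * (8 * n * D) * (32 * x) + 32 * x * (32 * x) * (3 * n * n * n) + 3 * n * n * n * (3 * n * n * n) * (8 * n * D)
    ≡⟨ factorʳ n D x ⟩
  8 * n * n * (256 * (D * D * x) + 384 * (n * (x * x)) + 9 * (n * n * n * n * n) * D)
    ≤⟨ *-monoʳ-≤ (8 * n * n) (+-monoˡ-≤ (9 * (n * n * n * n * n) * D) (+-monoʳ-≤ (256 * (D * D * x)) (*-monoʳ-≤ 384 (*-monoʳ-≤ n x²≤qD)))) ⟩
  8 * n * n * (256 * (D * D * x) + 384 * (n * (q * D)) + 9 * (n * n * n * n * n) * D)
    ≡⟨ collect n D x q ⟩
  8 * n * n * D * (256 * (D * x) + 384 * (n * q) + 9 * (n * n * n * n * n)) ∎)
  where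
  open ≤-Reasoning
  factorˡ : ∀ n D x → 8 * n * n * D * (288 * (n * n * x)) ≡ 3 * (8 * n * D * (32 * x) * (3 * n * n * n))
  factorˡ = solve-∀
  factorʳ : ∀ n D x → 8 * n * D * (8 * n * D) * (32 * x) + 32 * x * (32 * x) * (3 * n * n * n) + 3 * n * n * n * (3 * n * n * n) * (8 * n * D)
                    ≡ 8 * n * n * (256 * (D * D * x) + 384 * (n * (x * x)) + 9 * (n * n * n * n * n) * D)
  factorʳ = solve-∀
  collect : ∀ n D x q → 8 * n * n * (256 * (D * D * x) + 384 * (n * (q * D)) + 9 * (n * n * n * n * n) * D)
                      ≡ 8 * n * n * D * (256 * (D * x) + 384 * (n * q) + 9 * (n * n * n * n * n))
  collect = solve-∀

-- To be used with A = n²κ, B = nΣd², S = ΣDx, Z = Σd³ and N = 9n⁶. The multipliers 1, 64, 32, 32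
-- cancel S (256 = 64·4), Z (64·8 = 32·16) and B (384 = 32·8 + 32·4), and 288 - 128 - 32 - 32 = 96
-- copies of A remain.
eliminate : ∀ A B S Z N → 288 * A ≤ 256 * S + 384 * B + N → 4 * S + 8 * Z ≤ 2 * A →
            8 * B ≤ 16 * Z + A → 4 * B ≤ A → 96 * A ≤ N
eliminate A B S Z N h₁ h₂ h₃ h₄ = +-cancelʳ-≤ (192 * A + 256 * S + 512 * Z + 384 * B) _ _ (begin
  96 * A + (192 * A + 256 * S + 512 * Z + 384 * B)
    ≡⟨ split A B S Z ⟩
  288 * A + 64 * (4 * S + 8 * Z) + 32 * (8 * B) + 32 * (4 * B)
    ≤⟨ +-mono-≤ (+-mono-≤ (+-mono-≤ h₁ (*-monoʳ-≤ 64 h₂)) (*-monoʳ-≤ 32 h₃)) (*-monoʳ-≤ 32 h₄) ⟩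
  256 * S + 384 * B + N + 64 * (2 * A) + 32 * (16 * Z + A) + 32 * A
    ≡⟨ join A B S Z N ⟩
  N + (192 * A + 256 * S + 512 * Z + 384 * B) ∎)
  where
  open ≤-Reasoning
  split : ∀ A B S Z → 96 * A + (192 * A + 256 * S + 512 * Z + 384 * B) ≡ 288 * A + 64 * (4 * S + 8 * Z) + 32 * (8 * B) + 32 * (4 * B)
  split = solve-∀
  join : ∀ A B S Z N → 256 * S + 384 * B + N + 64 * (2 * A) + 32 * (16 * Z + A) + 32 * A ≡ N + (192 * A + 256 * S + 512 * Z + 384 * B)
  join = solve-∀

module _ {n : ℕ} (G : F₃₂-Avoiding n) where
  open F₃₂-Avoiding G

  private
    K = K₄ edge
    d = completions edge
    D = degree edge

  ordered-K₄s : ℕ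
  ordered-K₄s = sum₄ λ a b c d → ⟦ K a b c d ⟧

  private
    κ = ordered-K₄s

    K₄-sum : (Fin n → Fin n → Fin n → Fin n → ℕ) → ℕ
    K₄-sum f = sum₄ λ a b c d → ⟦ K a b c d ⟧ * f a b c d

    K₄-sum-mono : ∀ {f g : Fin n → Fin n → Fin n → Fin n → ℕ} →
                  (∀ a b c d → T (K a b c d) → f a b c d ≤ g a b c d) → K₄-sum f ≤ K₄-sum g
    K₄-sum-mono p = sum₄-mono λ a b c d → ⟦⟧-guard (K a b c d) (p a b c d)

    K₄-sum-+ : ∀ (f g : Fin n → Fin n → Fin n → Fin n → ℕ) →
               K₄-sum (λ a b c d → f a b c d + g a b c d) ≡ K₄-sum f + K₄-sum g
    K₄-sum-+ f g = trans (sum₄-cong λ a b c d → *-distribˡ-+ ⟦ K a b c d ⟧ (f a b c d) (g a b c d))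
                         (sum₄-+ (λ a b c d → ⟦ K a b c d ⟧ * f a b c d) (λ a b c d → ⟦ K a b c d ⟧ * g a b c d))

    K₄-sum-*ˡ : ∀ m (f : Fin n → Fin n → Fin n → Fin n → ℕ) → K₄-sum (λ a b c d → m * f a b c d) ≡ m * K₄-sum f
    K₄-sum-*ˡ m f = trans (sum₄-cong λ a b c d → pull ⟦ K a b c d ⟧ m (f a b c d))
                          (sum₄-*ˡ (λ a b c d → ⟦ K a b c d ⟧ * f a b c d) m)
      where
      pull : ∀ k m x → k * (m * x) ≡ m * (k * x)
      pull = solve-∀

    K₄-sum-const : ∀ m → K₄-sum (λ _ _ _ _ → m) ≡ m * κ
    K₄-sum-const m = trans (sum₄-cong λ a b c d → *-comm ⟦ K a b c d ⟧ m) (sum₄-*ˡ (λ a b c d → ⟦ K a b c d ⟧) m)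

    K₄-sum-swap₁ : ∀ (f : Fin n → Fin n → Fin n → Fin n → ℕ) → K₄-sum f ≡ K₄-sum (λ a b c d → f b a c d)
    K₄-sum-swap₁ f = trans (sum₄-swap₁ (λ a b c d → ⟦ K a b c d ⟧ * f a b c d))
      (sum₄-cong λ a b c d → cong (λ k → ⟦ k ⟧ * f b a c d) (K₄-swap₁ b a c d))

    K₄-sum-swap₂ : ∀ (f : Fin n → Fin n → Fin n → Fin n → ℕ) → K₄-sum f ≡ K₄-sum (λ a b c d → f a c b d)
    K₄-sum-swap₂ f = trans (sum₄-swap₂ (λ a b c d → ⟦ K a b c d ⟧ * f a b c d))
      (sum₄-cong λ a b c d → cong (λ k → ⟦ k ⟧ * f a c b d) (K₄-swap₂ a c b d))

    K₄-sum-swap₃ : ∀ (f : Fin n → Fin n → Fin n → Fin n → ℕ) → K₄-sum f ≡ K₄-sum (λ a b c d → f a b d c)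
    K₄-sum-swap₃ f = trans (sum₄-swap₃ (λ a b c d → ⟦ K a b c d ⟧ * f a b c d))
      (sum₄-cong λ a b c d → cong (λ k → ⟦ k ⟧ * f a b d c) (K₄-swap₃ a b d c))

    K₄-sum-+₄ : ∀ (f g h i : Fin n → Fin n → Fin n → Fin n → ℕ) → K₄-sum f ≡ K₄-sum g → K₄-sum g ≡ K₄-sum h → K₄-sum h ≡ K₄-sum i →
      K₄-sum (λ a b c d → f a b c d + g a b c d + h a b c d + i a b c d) ≡ 4 * K₄-sum f
    K₄-sum-+₄ f g h i f≡g g≡h h≡i
      rewrite K₄-sum-+ (λ a b c d → f a b c d + g a b c d + h a b c d) i
            | K₄-sum-+ (λ a b c d → f a b c d + g a b c d) h | K₄-sum-+ f g
            | sym h≡i | sym g≡h | sym f≡g = four (K₄-sum f)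
      where
      four : ∀ x → x + x + x + x ≡ 4 * x
      four = solve-∀

    -- By the symmetry of `K` all four summands have the same total. In the first one F does not
    -- involve the fourth vertex, and summing over that vertex gives d.
    K₄-sum-triples : ∀ (F : Fin n → Fin n → Fin n → ℕ) →
      K₄-sum (λ a b c d → F a b c + F a b d + F a c d + F b c d) ≡ 4 * sum₃ (λ a b c → d a b c * F a b c)
    K₄-sum-triples F = trans
      (K₄-sum-+₄ (λ a b c d → F a b c) (λ a b c d → F a b d) (λ a b c d → F a c d) (λ a b c d → F b c d)
        (K₄-sum-swap₃ (λ a b c d → F a b c)) (K₄-sum-swap₂ (λ a b c d → F a b d)) (K₄-sum-swap₁ (λ a b c d → F a c d)))
      (cong (4 *_) (sum₃-cong λ a b c → sym (*-distribʳ-sum (F a b c) (λ x → ⟦ K a b c x ⟧))))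

    K₄s-at : Fin n → ℕ
    K₄s-at a = sum₃ λ b c d → ⟦ K a b c d ⟧

    K₄-sum-vertices : ∀ (F : Fin n → ℕ) →
      K₄-sum (λ a b c d → F a + F b + F c + F d) ≡ 4 * sum (λ a → F a * K₄s-at a)
    K₄-sum-vertices F = trans
      (K₄-sum-+₄ (λ a b c d → F a) (λ a b c d → F b) (λ a b c d → F c) (λ a b c d → F d)
        (K₄-sum-swap₁ (λ a b c d → F a)) (K₄-sum-swap₂ (λ a b c d → F b)) (K₄-sum-swap₃ (λ a b c d → F c)))
      (cong (4 *_) (sum-cong-≗ λ a → trans (sum₃-cong λ b c d → *-comm ⟦ K a b c d ⟧ (F a))
                                           (sum₃-*ˡ (F a) (λ b c d → ⟦ K a b c d ⟧))))

    Σd² Σd³ ΣDx : ℕ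
    Σd² = sum₃ λ a b c → d a b c * d a b c
    Σd³ = sum₃ λ a b c → d a b c * (d a b c * d a b c)
    ΣDx = sum λ a → D a * K₄s-at a

    -- The left side is the sum over all K₄s of d over their four triples. For one K₄ the sets
    -- counted by these four values are disjoint, so they contribute at most n.
    4Σd²≤nκ : 4 * Σd² ≤ n * κ
    4Σd²≤nκ = begin
      4 * Σd²                                                  ≡⟨ K₄-sum-triples d ⟨
      K₄-sum (λ a b c e → d a b c + d a b e + d a c e + d b c e) ≤⟨ K₄-sum-mono pointwise ⟩
      K₄-sum (λ _ _ _ _ → n)                                   ≡⟨ K₄-sum-const n ⟩
      n * κ                                                    ∎
      where
      open ≤-Reasoning
      pointwise : ∀ a b c e → T (K a b c e) → d a b c + d a b e + d a c e + d b c e ≤ n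
      pointwise a b c e k = begin
        d a b c + d a b e + d a c e + d b c e
          ≡⟨ cong (λ s → s + d a c e + d b c e) (∑-distrib-+ (λ x → ⟦ K a b c x ⟧) (λ x → ⟦ K a b e x ⟧)) ⟨
        sum (λ x → ⟦ K a b c x ⟧ + ⟦ K a b e x ⟧) + d a c e + d b c e
          ≡⟨ cong (_+ d b c e) (∑-distrib-+ (λ x → ⟦ K a b c x ⟧ + ⟦ K a b e x ⟧) (λ x → ⟦ K a c e x ⟧)) ⟨
        sum (λ x → ⟦ K a b c x ⟧ + ⟦ K a b e x ⟧ + ⟦ K a c e x ⟧) + d b c e
          ≡⟨ ∑-distrib-+ (λ x → ⟦ K a b c x ⟧ + ⟦ K a b e x ⟧ + ⟦ K a c e x ⟧) (λ x → ⟦ K b c e x ⟧) ⟨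
        sum (λ x → ⟦ K a b c x ⟧ + ⟦ K a b e x ⟧ + ⟦ K a c e x ⟧ + ⟦ K b c e x ⟧)
          ≤⟨ sum-mono (completions-disjoint a b c e k) ⟩
        sum {n} (λ _ → 1)
          ≡⟨ sum-const n 1 ⟩
        n * 1
          ≡⟨ *-identityʳ n ⟩
        n ∎

    sum₂-+₄ : ∀ (f g h i : Fin n → Fin n → ℕ) →
              sum₂ (λ x y → f x y + g x y + h x y + i x y) ≡ sum₂ f + sum₂ g + sum₂ h + sum₂ i
    sum₂-+₄ f g h i
      rewrite sum₂-+ (λ x y → f x y + g x y + h x y) i | sum₂-+ (λ x y → f x y + g x y) h | sum₂-+ f g = refl

    -- Double counting turns the left side into a sum over K₄s of ΣD + 2Σd². Writing each D and each
    -- d² as a sum over pairs x, y makes `K₄-pair-bound` applicable term by term.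
    4ΣDx+8Σd³≤2n²κ : 4 * ΣDx + 8 * Σd³ ≤ 2 * (n * n * κ)
    4ΣDx+8Σd³≤2n²κ = begin
      4 * ΣDx + 8 * Σd³
        ≡⟨ cong (λ t → 4 * ΣDx + t) (*-assoc 2 4 Σd³) ⟩
      4 * ΣDx + 2 * (4 * Σd³)
        ≡⟨ cong₂ _+_ (K₄-sum-vertices D) (cong (2 *_) (K₄-sum-triples d²)) ⟨
      K₄-sum Ds + 2 * K₄-sum d²s
        ≡⟨ cong (λ t → K₄-sum Ds + t) (K₄-sum-*ˡ 2 d²s) ⟨
      K₄-sum Ds + K₄-sum (λ a b c e → 2 * d²s a b c e)
        ≡⟨ K₄-sum-+ Ds (λ a b c e → 2 * d²s a b c e) ⟨
      K₄-sum (λ a b c e → Ds a b c e + 2 * d²s a b c e)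
        ≤⟨ K₄-sum-mono pointwise ⟩
      K₄-sum (λ _ _ _ _ → n * (n * 2))
        ≡⟨ K₄-sum-const (n * (n * 2)) ⟩
      n * (n * 2) * κ
        ≡⟨ regroup n κ ⟩
      2 * (n * n * κ) ∎
      where
      open ≤-Reasoning
      regroup : ∀ n κ → n * (n * 2) * κ ≡ 2 * (n * n * κ)
      regroup = solve-∀
      d² : Fin n → Fin n → Fin n → ℕ
      d² a b c = d a b c * d a b c
      Ds d²s : Fin n → Fin n → Fin n → Fin n → ℕ
      Ds a b c e = D a + D b + D c + D e
      d²s a b c e = d² a b c + d² a b e + d² a c e + d² b c e
      KK : Fin n → Fin n → Fin n → Fin n → Fin n → ℕ
      KK a b c x y = ⟦ K a b c x ⟧ * ⟦ K a b c y ⟧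
      d²≡ : ∀ a b c → d² a b c ≡ sum₂ (KK a b c)
      d²≡ a b c = sum-*-sum (λ x → ⟦ K a b c x ⟧) (λ x → ⟦ K a b c x ⟧)
      pointwise : ∀ a b c e → T (K a b c e) → Ds a b c e + 2 * d²s a b c e ≤ n * (n * 2)
      pointwise a b c e k = begin
        Ds a b c e + 2 * d²s a b c e
          ≡⟨ cong (λ s → Ds a b c e + 2 * s) (cong₂ _+_ (cong₂ _+_ (cong₂ _+_ (d²≡ a b c) (d²≡ a b e)) (d²≡ a c e)) (d²≡ b c e)) ⟩
        Ds a b c e + 2 * (sum₂ (KK a b c) + sum₂ (KK a b e) + sum₂ (KK a c e) + sum₂ (KK b c e))
          ≡⟨ cong₂ (λ s t → s + 2 * t)
               (sum₂-+₄ (λ x y → ⟦ edge a x y ⟧) (λ x y → ⟦ edge b x y ⟧) (λ x y → ⟦ edge c x y ⟧) (λ x y → ⟦ edge e x y ⟧))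
               (sum₂-+₄ (KK a b c) (KK a b e) (KK a c e) (KK b c e)) ⟨
        sum₂ E₄ + 2 * sum₂ KK₄
          ≡⟨ cong (λ t → sum₂ E₄ + t) (sum₂-*ˡ 2 KK₄) ⟨
        sum₂ E₄ + sum₂ (λ x y → 2 * KK₄ x y)
          ≡⟨ sum₂-+ E₄ (λ x y → 2 * KK₄ x y) ⟨
        sum₂ (λ x y → E₄ x y + 2 * KK₄ x y)
          ≤⟨ sum₂-mono (K₄-pair-bound a b c e k) ⟩
        sum₂ {n} (λ _ _ → 2)
          ≡⟨ sum-cong-≗ {n} (λ _ → sum-const n 2) ⟩
        sum {n} (λ _ → n * 2)
          ≡⟨ sum-const n (n * 2) ⟩
        n * (n * 2) ∎
        where
        E₄ KK₄ : Fin n → Fin n → ℕ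
        E₄ x y = ⟦ edge a x y ⟧ + ⟦ edge b x y ⟧ + ⟦ edge c x y ⟧ + ⟦ edge e x y ⟧
        KK₄ x y = KK a b c x y + KK a b e x y + KK a c e x y + KK b c e x y

    -- Termwise this is d(4d - n)² ≥ 0, with equality at d = 0 and d = n/4, and the sum of d over
    -- ordered triples is κ by definition.
    8nΣd²≤16Σd³+n²κ : 8 * (n * Σd²) ≤ 16 * Σd³ + n * n * κ
    8nΣd²≤16Σd³+n²κ = begin
      8 * (n * Σd²)
        ≡⟨ *-assoc 8 n Σd² ⟨
      8 * n * Σd²
        ≡⟨ sum₃-*ˡ (8 * n) (λ a b c → d a b c * d a b c) ⟨
      sum₃ (λ a b c → 8 * n * (d a b c * d a b c))
        ≤⟨ sum₃-mono (λ a b c → pointwise (d a b c)) ⟩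
      sum₃ (λ a b c → 16 * (d a b c * (d a b c * d a b c)) + n * n * d a b c)
        ≡⟨ sum₃-+ (λ a b c → 16 * (d a b c * (d a b c * d a b c))) (λ a b c → n * n * d a b c) ⟩
      sum₃ (λ a b c → 16 * (d a b c * (d a b c * d a b c))) + sum₃ (λ a b c → n * n * d a b c)
        ≡⟨ cong₂ _+_ (sum₃-*ˡ 16 (λ a b c → d a b c * (d a b c * d a b c))) (sum₃-*ˡ (n * n) d) ⟩
      16 * Σd³ + n * n * κ ∎
      where
      open ≤-Reasoning
      expandˡ : ∀ n t → 8 * n * (t * t) ≡ t * (2 * (4 * t * n))
      expandˡ = solve-∀
      expandʳ : ∀ n t → t * (4 * t * (4 * t) + n * n) ≡ 16 * (t * (t * t)) + n * n * t
      expandʳ = solve-∀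
      pointwise : ∀ t → 8 * n * (t * t) ≤ 16 * (t * (t * t)) + n * n * t
      pointwise t = begin
        8 * n * (t * t)                   ≡⟨ expandˡ n t ⟩
        t * (2 * (4 * t * n))             ≤⟨ *-monoʳ-≤ t (2ab≤a²+b² (4 * t) n) ⟩
        t * (4 * t * (4 * t) + n * n)     ≡⟨ expandʳ n t ⟩
        16 * (t * (t * t)) + n * n * t    ∎

    d²-at : Fin n → ℕ
    d²-at a = sum₂ λ b c → d a b c * d a b c

    -- Cauchy-Schwarz for d times the edge indicator, applied first over c and then over b. The
    -- indicator may be inserted because a triple that is not an edge has no completions.
    x²≤qD : ∀ a → K₄s-at a * K₄s-at a ≤ d²-at a * D a
    x²≤qD a = sum-Cauchy (λ b → sum λ c → d a b c) (λ b → sum λ c → d a b c * d a b c) (λ b → sum λ c → ⟦ edge a b c ⟧)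
      λ b → sum-Cauchy (d a b) (λ c → d a b c * d a b c) (λ c → ⟦ edge a b c ⟧) (pointwise b)
      where
      pointwise : ∀ b c → d a b c * d a b c ≤ d a b c * d a b c * ⟦ edge a b c ⟧
      pointwise b c with edge a b c
      ... | true  = ≤-reflexive (sym (*-identityʳ _))
      ... | false rewrite sum-const n 0 | *-zeroʳ n = z≤n

    -- The sum of `vertex-AM-GM` over all vertices: `K₄s-at` sums to κ and `d²-at` to Σd².
    288n²κ≤ : 288 * (n * n * κ) ≤ 256 * ΣDx + 384 * (n * Σd²) + 9 * (n * n * n * n * n * n)
    288n²κ≤ = begin
      288 * (n * n * κ)
        ≡⟨ *-assoc 288 (n * n) κ ⟨
      288 * (n * n) * κ
        ≡⟨ *-distribˡ-sum (288 * (n * n)) K₄s-at ⟩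
      sum (λ a → 288 * (n * n) * K₄s-at a)
        ≤⟨ sum-mono (λ a → ≤-trans (≤-reflexive (*-assoc 288 (n * n) (K₄s-at a))) (≤-trans (vertex-AM-GM n (D a) (K₄s-at a) (d²-at a) (x²≤qD a))
             (≤-reflexive (cong (λ s → 256 * (D a * K₄s-at a) + s + 9 * (n * n * n * n * n)) (sym (*-assoc 384 n (d²-at a))))))) ⟩
      sum (λ a → 256 * (D a * K₄s-at a) + 384 * n * d²-at a + N)
        ≡⟨ ∑-distrib-+ (λ a → 256 * (D a * K₄s-at a) + 384 * n * d²-at a) (λ _ → N) ⟩
      sum (λ a → 256 * (D a * K₄s-at a) + 384 * n * d²-at a) + sum {n} (λ _ → N)
        ≡⟨ cong₂ _+_ (∑-distrib-+ (λ a → 256 * (D a * K₄s-at a)) (λ a → 384 * n * d²-at a)) (sum-const n N) ⟩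
      sum (λ a → 256 * (D a * K₄s-at a)) + sum (λ a → 384 * n * d²-at a) + n * N
        ≡⟨ cong (_+ n * N) (cong₂ _+_ (*-distribˡ-sum 256 (λ a → D a * K₄s-at a)) (*-distribˡ-sum (384 * n) d²-at)) ⟨
      256 * ΣDx + 384 * n * Σd² + n * N
        ≡⟨ cong₂ (λ s t → 256 * ΣDx + s + t) (*-assoc 384 n Σd²) (collect n) ⟩
      256 * ΣDx + 384 * (n * Σd²) + 9 * (n * n * n * n * n * n) ∎
      where
      open ≤-Reasoning
      N = 9 * (n * n * n * n * n)
      collect : ∀ n → n * (9 * (n * n * n * n * n)) ≡ 9 * (n * n * n * n * n * n)
      collect = solve-∀

  96n²κ≤9n⁶ : 96 * (n * n * κ) ≤ 9 * (n * n * n * n * n * n)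
  96n²κ≤9n⁶ = eliminate (n * n * κ) (n * Σd²) ΣDx Σd³ (9 * (n * n * n * n * n * n))
    288n²κ≤ 4ΣDx+8Σd³≤2n²κ 8nΣd²≤16Σd³+n²κ
    -- The last hypothesis of `eliminate` is n times `4Σd²≤nκ`.
    (≤-trans (≤-reflexive (trans (sym (*-assoc 4 n Σd²)) (trans (cong (_* Σd²) (*-comm 4 n)) (*-assoc n 4 Σd²))))
      (≤-trans (*-monoʳ-≤ n 4Σd²≤nκ) (≤-reflexive (sym (*-assoc n n κ)))))

ordered-K₄s-bound : ∀ {n} (G : F₃₂-Avoiding n) → 32 * ordered-K₄s G ≤ 3 * (n * n * n * n)
ordered-K₄s-bound {zero}  G = z≤n
ordered-K₄s-bound {n@(suc _)} G = *-cancelˡ-≤ (3 * (n * n)) (begin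
  3 * (n * n) * (32 * ordered-K₄s G)    ≡⟨ regroupˡ n (ordered-K₄s G) ⟩
  96 * (n * n * ordered-K₄s G)          ≤⟨ 96n²κ≤9n⁶ G ⟩
  9 * (n * n * n * n * n * n)           ≡⟨ regroupʳ n ⟩
  3 * (n * n) * (3 * (n * n * n * n))   ∎)
  where
  open ≤-Reasoning
  regroupˡ : ∀ n κ → 3 * (n * n) * (32 * κ) ≡ 96 * (n * n * κ)
  regroupˡ = solve-∀
  regroupʳ : ∀ n → 9 * (n * n * n * n * n * n) ≡ 3 * (n * n) * (3 * (n * n * n * n))
  regroupʳ = solve-∀

-- Ordered and unordered K₄s

count≤⟦_⟧ : ∀ t p q r s → (T p → T t) → (T q → T t) → (T r → T t) → (T s → T t) →
            ¬ (T p × T q) → ¬ (T p × T r) → ¬ (T p × T s) → ¬ (T q × T r) → ¬ (T q × T s) → ¬ (T r × T s) →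
            ⟦ p ⟧ + ⟦ q ⟧ + ⟦ r ⟧ + ⟦ s ⟧ ≤ ⟦ t ⟧
count≤⟦ true  ⟧ p q r s _ _ _ _ pq pr ps qr qs rs = count≤1 p q r s pq pr ps qr qs rs
count≤⟦ false ⟧ p q r s ¬p ¬q ¬r ¬s _ _ _ _ _ _
  rewrite ¬T⇒0 p ¬p | ¬T⇒0 q ¬q | ¬T⇒0 r ¬r | ¬T⇒0 s ¬s = z≤n

module _ {n : ℕ} where

  asc₂ : Fin n → Fin n → Bool
  asc₂ a b = ⌊ a <ᶠ? b ⌋

  asc₃ : Fin n → Fin n → Fin n → Bool
  asc₃ a b c = asc₂ a b ∧ asc₂ b c

  asc₄ : Fin n → Fin n → Fin n → Fin n → Bool
  asc₄ a b c d = asc₂ a b ∧ asc₃ b c d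

  asc₂⁻ : ∀ a b → T (asc₂ a b) → a <ᶠ b
  asc₂⁻ a b = toWitness {a? = a <ᶠ? b}

  asc₂⁺ : ∀ a b → a <ᶠ b → T (asc₂ a b)
  asc₂⁺ a b = fromWitness {a? = a <ᶠ? b}

  asc₃⁻ : ∀ a b c → T (asc₃ a b c) → a <ᶠ b × b <ᶠ c
  asc₃⁻ a b c p with Equivalence.to (T-∧ {asc₂ a b}) p
  ... | ab , bc = asc₂⁻ a b ab , asc₂⁻ b c bc

  asc₃⁺ : ∀ a b c → a <ᶠ b → b <ᶠ c → T (asc₃ a b c)
  asc₃⁺ a b c ab bc = Equivalence.from (T-∧ {asc₂ a b}) (asc₂⁺ a b ab , asc₂⁺ b c bc)

  asc₄⁻ : ∀ a b c d → T (asc₄ a b c d) → a <ᶠ b × b <ᶠ c × c <ᶠ d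
  asc₄⁻ a b c d p with Equivalence.to (T-∧ {asc₂ a b}) p
  ... | ab , bcd = asc₂⁻ a b ab , asc₃⁻ b c d bcd

  asc₂-orders : ∀ a b → ⟦ asc₂ a b ⟧ + ⟦ asc₂ b a ⟧ ≤ 1
  asc₂-orders a b = ≤-trans (≤-reflexive (sym (trans (+-identityʳ _) (+-identityʳ _))))
    (count≤1 (asc₂ a b) (asc₂ b a) false false
      (λ (p , q) → <-asym (asc₂⁻ a b p) (asc₂⁻ b a q)) proj₂ proj₂ proj₂ proj₂ proj₂)

  -- At most one of the three positions for c relative to a and b gives an increasing triple, and
  -- each such triple keeps a below b. The `false` fills the fourth slot of the counting lemma.
  asc₃-insertions : ∀ a b c → ⟦ asc₃ a b c ⟧ + ⟦ asc₃ a c b ⟧ + ⟦ asc₃ c a b ⟧ ≤ ⟦ asc₂ a b ⟧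
  asc₃-insertions a b c = ≤-trans (≤-reflexive (sym (+-identityʳ _)))
    (count≤⟦ asc₂ a b ⟧ (asc₃ a b c) (asc₃ a c b) (asc₃ c a b) false
      (λ p → let (ab , _) = asc₃⁻ a b c p in asc₂⁺ a b ab)
      (λ p → let (ac , cb) = asc₃⁻ a c b p in asc₂⁺ a b (<-trans ac cb))
      (λ p → let (_ , ab) = asc₃⁻ c a b p in asc₂⁺ a b ab)
      (λ ())
      (λ (p , q) → let (_ , bc) = asc₃⁻ a b c p ; (_ , cb) = asc₃⁻ a c b q in <-asym bc cb)
      (λ (p , q) → let (ab , bc) = asc₃⁻ a b c p ; (ca , _) = asc₃⁻ c a b q in <-asym (<-trans ab bc) ca)
      proj₂
      (λ (p , q) → let (ac , _) = asc₃⁻ a c b p ; (ca , _) = asc₃⁻ c a b q in <-asym ac ca)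
      proj₂ proj₂)

  asc₄-insertions : ∀ a b c d → ⟦ asc₄ a b c d ⟧ + ⟦ asc₄ a b d c ⟧ + ⟦ asc₄ a d b c ⟧ + ⟦ asc₄ d a b c ⟧ ≤ ⟦ asc₃ a b c ⟧
  asc₄-insertions a b c d = count≤⟦ asc₃ a b c ⟧ (asc₄ a b c d) (asc₄ a b d c) (asc₄ a d b c) (asc₄ d a b c)
    (λ p → let (ab , bc , _) = asc₄⁻ a b c d p in asc₃⁺ a b c ab bc)
    (λ p → let (ab , bd , dc) = asc₄⁻ a b d c p in asc₃⁺ a b c ab (<-trans bd dc))
    (λ p → let (ad , db , bc) = asc₄⁻ a d b c p in asc₃⁺ a b c (<-trans ad db) bc)
    (λ p → let (_ , ab , bc) = asc₄⁻ d a b c p in asc₃⁺ a b c ab bc)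
    (λ (p , q) → let (_ , _ , cd) = asc₄⁻ a b c d p ; (_ , _ , dc) = asc₄⁻ a b d c q in <-asym cd dc)
    (λ (p , q) → let (_ , bc , cd) = asc₄⁻ a b c d p ; (_ , db , _) = asc₄⁻ a d b c q in <-asym (<-trans bc cd) db)
    (λ (p , q) → let (ab , bc , cd) = asc₄⁻ a b c d p ; (da , _ , _) = asc₄⁻ d a b c q in <-asym (<-trans ab (<-trans bc cd)) da)
    (λ (p , q) → let (_ , bd , _) = asc₄⁻ a b d c p ; (_ , db , _) = asc₄⁻ a d b c q in <-asym bd db)
    (λ (p , q) → let (ab , bd , _) = asc₄⁻ a b d c p ; (da , _ , _) = asc₄⁻ d a b c q in <-asym (<-trans ab bd) da)
    (λ (p , q) → let (ad , _ , _) = asc₄⁻ a d b c p ; (da , _ , _) = asc₄⁻ d a b c q in <-asym ad da)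

module _ {n : ℕ} (f : Fin n → Fin n → Fin n → Fin n → ℕ)
         (f-swap₁ : ∀ a b c d → f a b c d ≡ f b a c d)
         (f-swap₂ : ∀ a b c d → f a b c d ≡ f a c b d)
         (f-swap₃ : ∀ a b c d → f a b c d ≡ f a b d c) where
  private
    ∑f : (Fin n → Fin n → Fin n → Fin n → ℕ) → ℕ
    ∑f g = sum₄ λ a b c d → g a b c d * f a b c d

    ∑f-mono : ∀ {g h : Fin n → Fin n → Fin n → Fin n → ℕ} → (∀ a b c d → g a b c d ≤ h a b c d) → ∑f g ≤ ∑f h
    ∑f-mono p = sum₄-mono λ a b c d → *-monoˡ-≤ (f a b c d) (p a b c d)

    ∑f-+ : ∀ (g h : Fin n → Fin n → Fin n → Fin n → ℕ) → ∑f (λ a b c d → g a b c d + h a b c d) ≡ ∑f g + ∑f h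
    ∑f-+ g h = trans (sum₄-cong λ a b c d → *-distribʳ-+ (f a b c d) (g a b c d) (h a b c d))
      (sum₄-+ (λ a b c d → g a b c d * f a b c d) (λ a b c d → h a b c d * f a b c d))

    ∑f-swap₁ : ∀ (g : Fin n → Fin n → Fin n → Fin n → ℕ) → ∑f (λ a b c d → g b a c d) ≡ ∑f g
    ∑f-swap₁ g = trans (sum₄-swap₁ (λ a b c d → g b a c d * f a b c d))
      (sum₄-cong λ a b c d → cong (g a b c d *_) (f-swap₁ b a c d))

    ∑f-swap₂ : ∀ (g : Fin n → Fin n → Fin n → Fin n → ℕ) → ∑f (λ a b c d → g a c b d) ≡ ∑f g
    ∑f-swap₂ g = trans (sum₄-swap₂ (λ a b c d → g a c b d * f a b c d))
      (sum₄-cong λ a b c d → cong (g a b c d *_) (f-swap₂ a c b d))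

    ∑f-swap₃ : ∀ (g : Fin n → Fin n → Fin n → Fin n → ℕ) → ∑f (λ a b c d → g a b d c) ≡ ∑f g
    ∑f-swap₃ g = trans (sum₄-swap₃ (λ a b c d → g a b d c * f a b c d))
      (sum₄-cong λ a b c d → cong (g a b c d *_) (f-swap₃ a b d c))

    g₂ g₃ g₄ : Fin n → Fin n → Fin n → Fin n → ℕ
    g₂ a b c d = ⟦ asc₂ a b ⟧
    g₃ a b c d = ⟦ asc₃ a b c ⟧
    g₄ a b c d = ⟦ asc₄ a b c d ⟧

    2∑g₂≤∑ : 2 * ∑f g₂ ≤ sum₄ f
    2∑g₂≤∑ = begin
      2 * ∑f g₂                                     ≡⟨ cong (λ t → ∑f g₂ + t) (trans (+-identityʳ _) (sym (∑f-swap₁ g₂))) ⟩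
      ∑f g₂ + ∑f (λ a b c d → g₂ b a c d)           ≡⟨ ∑f-+ g₂ (λ a b c d → g₂ b a c d) ⟨
      ∑f (λ a b c d → g₂ a b c d + g₂ b a c d)      ≤⟨ ∑f-mono (λ a b _ _ → asc₂-orders a b) ⟩
      ∑f (λ _ _ _ _ → 1)                            ≡⟨ sum₄-cong (λ a b c d → +-identityʳ (f a b c d)) ⟩
      sum₄ f                                        ∎
      where open ≤-Reasoning

    3∑g₃≤∑g₂ : 3 * ∑f g₃ ≤ ∑f g₂
    3∑g₃≤∑g₂ = begin
      -- The three insertion terms are rearrangements of `g₃`, so the symmetry of f gives them equal
      -- weight.
      3 * ∑f g₃                                         ≡⟨ three (∑f g₃) ⟩
      ∑f g₃ + ∑f g₃ + ∑f g₃                             ≡⟨ cong₂ (λ s t → ∑f g₃ + s + t) (∑f-swap₂ g₃)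
                                                             (trans (∑f-swap₂ (λ a b c d → g₃ b a c d)) (∑f-swap₁ g₃)) ⟨
      ∑f g₃ + ∑f g₃′ + ∑f g₃″                           ≡⟨ cong (_+ ∑f g₃″) (∑f-+ g₃ g₃′) ⟨
      ∑f (λ a b c d → g₃ a b c d + g₃′ a b c d) + ∑f g₃″ ≡⟨ ∑f-+ (λ a b c d → g₃ a b c d + g₃′ a b c d) g₃″ ⟨
      ∑f (λ a b c d → g₃ a b c d + g₃′ a b c d + g₃″ a b c d) ≤⟨ ∑f-mono (λ a b c _ → asc₃-insertions a b c) ⟩
      ∑f g₂                                             ∎
      where
      open ≤-Reasoning
      g₃′ g₃″ : Fin n → Fin n → Fin n → Fin n → ℕ
      g₃′ a b c d = g₃ a c b d
      g₃″ a b c d = g₃ c a b d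
      three : ∀ x → 3 * x ≡ x + x + x
      three = solve-∀

    4∑g₄≤∑g₃ : 4 * ∑f g₄ ≤ ∑f g₃
    4∑g₄≤∑g₃ = begin
      4 * ∑f g₄
        ≡⟨ four (∑f g₄) ⟩
      ∑f g₄ + ∑f g₄ + ∑f g₄ + ∑f g₄
        ≡⟨ cong₂ _+_ (cong₂ (λ s t → ∑f g₄ + s + t) g₄′≡ g₄″≡) g₄‴≡ ⟨
      ∑f g₄ + ∑f g₄′ + ∑f g₄″ + ∑f g₄‴
        ≡⟨ cong (λ s → s + ∑f g₄″ + ∑f g₄‴) (∑f-+ g₄ g₄′) ⟨
      ∑f (λ a b c d → g₄ a b c d + g₄′ a b c d) + ∑f g₄″ + ∑f g₄‴
        ≡⟨ cong (_+ ∑f g₄‴) (∑f-+ (λ a b c d → g₄ a b c d + g₄′ a b c d) g₄″) ⟨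
      ∑f (λ a b c d → g₄ a b c d + g₄′ a b c d + g₄″ a b c d) + ∑f g₄‴
        ≡⟨ ∑f-+ (λ a b c d → g₄ a b c d + g₄′ a b c d + g₄″ a b c d) g₄‴ ⟨
      ∑f (λ a b c d → g₄ a b c d + g₄′ a b c d + g₄″ a b c d + g₄‴ a b c d)
        ≤⟨ ∑f-mono asc₄-insertions ⟩
      ∑f g₃ ∎
      where
      open ≤-Reasoning
      g₄′ g₄″ g₄‴ : Fin n → Fin n → Fin n → Fin n → ℕ
      g₄′ a b c d = g₄ a b d c
      g₄″ a b c d = g₄ a d b c
      g₄‴ a b c d = g₄ d a b c
      g₄′≡ : ∑f g₄′ ≡ ∑f g₄
      g₄′≡ = ∑f-swap₃ g₄
      g₄″≡ : ∑f g₄″ ≡ ∑f g₄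
      g₄″≡ = trans (∑f-swap₃ (λ a b c d → g₄ a c b d)) (∑f-swap₂ g₄)
      g₄‴≡ : ∑f g₄‴ ≡ ∑f g₄
      g₄‴≡ = trans (∑f-swap₃ (λ a b c d → g₄ c a b d)) (trans (∑f-swap₂ (λ a b c d → g₄ b a c d)) (∑f-swap₁ g₄))
      four : ∀ x → 4 * x ≡ x + x + x + x
      four = solve-∀

  -- Of the 4! orderings of a quadruple at most one is increasing. Inserting one variable at a time
  -- gives 24 = 2·3·4 and replaces the comparison of all 24 permutations by three short ones.
  24∑asc≤∑ : 24 * sum₄ (λ a b c d → ⟦ asc₄ a b c d ⟧ * f a b c d) ≤ sum₄ f
  24∑asc≤∑ = begin
    24 * ∑f g₄              ≡⟨ regroup (∑f g₄) ⟩
    2 * (3 * (4 * ∑f g₄))   ≤⟨ *-monoʳ-≤ 2 (*-monoʳ-≤ 3 4∑g₄≤∑g₃) ⟩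
    2 * (3 * ∑f g₃)         ≤⟨ *-monoʳ-≤ 2 3∑g₃≤∑g₂ ⟩
    2 * ∑f g₂               ≤⟨ 2∑g₂≤∑ ⟩
    sum₄ f                  ∎
    where
    open ≤-Reasoning
    regroup : ∀ x → 24 * x ≡ 2 * (3 * (4 * x))
    regroup = solve-∀

-- The list count `eK4` as a sum of indicators.

module _ {A : Set} {P : A → Set} (P? : Decidable P) where

  length-filter-concatMap : ∀ {n} (f : Fin n → List A) →
    length (filter P? (concatMap f (allFin n))) ≡ sum λ i → length (filter P? (f i))
  length-filter-concatMap {n} f = tabulated n id
    where
    -- `allFin n` is the tabulation of `id`; the induction needs arbitrary `g`, since the tail
    -- tabulates `g ∘ fs`.
    tabulated : ∀ m (g : Fin m → Fin n) →
      length (filter P? (concatMap f (List.tabulate g))) ≡ sum λ i → length (filter P? (f (g i)))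
    tabulated zero    g = refl
    tabulated (suc m) g = begin
      length (filter P? (f (g f0) ++ rest))
        ≡⟨ cong length (filter-++ P? (f (g f0)) rest) ⟩
      length (filter P? (f (g f0)) ++ filter P? rest)
        ≡⟨ length-++ (filter P? (f (g f0))) ⟩
      length (filter P? (f (g f0))) + length (filter P? rest)
        ≡⟨ cong (λ t → length (filter P? (f (g f0))) + t) (tabulated m (g ∘ fs)) ⟩
      length (filter P? (f (g f0))) + sum (λ i → length (filter P? (f (g (fs i))))) ∎
      where
      open ≡-Reasoning
      rest = concatMap f (List.tabulate (g ∘ fs))

-- `asc₄` is bracketed like the test in `quads`, so the nested `concatMap` unfolds one summation at
-- a time.
eK4-sum : ∀ {n} (G : Graph3 n) → eK4 G ≡ sum₄ λ a b c d → ⟦ asc₄ a b c d ⟧ * ⟦ isK4 G (a , b , c , d) ⟧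
eK4-sum {n} G =
  trans (length-filter-concatMap P? quads₃) (sum-cong-≗ λ a →
  trans (length-filter-concatMap P? (quads₂ a)) (sum-cong-≗ λ b →
  trans (length-filter-concatMap P? (quads₁ a b)) (sum-cong-≗ λ c →
  trans (length-filter-concatMap P? (quads₀ a b c)) (sum-cong-≗ λ d →
  leaf (asc₄ a b c d) (a , b , c , d)))))
  where
  P? = λ q → isK4 G q ≟ᵇ true
  quads₀ : Fin n → Fin n → Fin n → Fin n → List (Fin n × Fin n × Fin n × Fin n)
  quads₀ a b c d = if asc₄ a b c d then (a , b , c , d) ∷ [] else []
  quads₁ : Fin n → Fin n → Fin n → List (Fin n × Fin n × Fin n × Fin n)
  quads₁ a b c = concatMap (quads₀ a b c) (allFin n)
  quads₂ : Fin n → Fin n → List (Fin n × Fin n × Fin n × Fin n)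
  quads₂ a b = concatMap (quads₁ a b) (allFin n)
  quads₃ : Fin n → List (Fin n × Fin n × Fin n × Fin n)
  quads₃ a = concatMap (quads₂ a) (allFin n)
  leaf : ∀ t q → length (filter P? (if t then q ∷ [] else [])) ≡ ⟦ t ⟧ * ⟦ isK4 G q ⟧
  leaf true q with isK4 G q
  ... | true  = refl
  ... | false = refl
  leaf false q = refl

-- Edges on distinct vertices and the bound on `eK4`.

apart : ∀ {m} → Fin m → Fin m → Bool
apart a b = not ⌊ a ≟ b ⌋

apart-sym : ∀ {m} (a b : Fin m) → apart a b ≡ apart b a
apart-sym a b with a ≟ b | b ≟ a
... | yes _   | yes _   = refl
... | no  _   | no  _   = refl
... | yes a≡b | no  b≢a = contradiction (sym a≡b) b≢a
... | no  a≢b | yes b≡a = contradiction (sym b≡a) a≢b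

apart⁻ : ∀ {m} (a b : Fin m) → T (apart a b) → a ≢ b
apart⁻ a b with a ≟ b
... | no a≢b = λ _ → a≢b

apart⁺ : ∀ {m} (a b : Fin m) → a ≢ b → T (apart a b)
apart⁺ a b a≢b with a ≟ b
... | yes a≡b = a≢b a≡b
... | no  _   = tt

apart₃ : ∀ {m} → Fin m → Fin m → Fin m → Bool
apart₃ a b c = apart a b ∧ apart a c ∧ apart b c

apart₃-swap₁ : ∀ {m} (a b c : Fin m) → apart₃ a b c ≡ apart₃ b a c
apart₃-swap₁ a b c = cong₂ _∧_ (apart-sym a b) (∧-comm (apart a c) (apart b c))

apart₃-swap₂ : ∀ {m} (a b c : Fin m) → apart₃ a b c ≡ apart₃ a c b
apart₃-swap₂ a b c = trans (sym (∧-assoc (apart a b) (apart a c) (apart b c)))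
  (trans (cong₂ _∧_ (∧-comm (apart a b) (apart a c)) (apart-sym b c)) (∧-assoc (apart a c) (apart a b) (apart c b)))

apart₃⁻ : ∀ {m} (a b c : Fin m) → T (apart₃ a b c) → a ≢ b × a ≢ c × b ≢ c
apart₃⁻ a b c t with Equivalence.to (T-∧ {apart a b}) t
... | ab , t′ with Equivalence.to (T-∧ {apart a c}) t′
...   | ac , bc = apart⁻ a b ab , apart⁻ a c ac , apart⁻ b c bc

module _ {n : ℕ} (G : Graph3 n) where
  private
    -- `E` is arbitrary on triples with a repeated vertex; masking those values makes every edge a
    -- genuine 3-set.
    edge : Fin n → Fin n → Fin n → Bool
    edge a b c = apart₃ a b c ∧ E G a b c

    edge⁻ : ∀ a b c → T (edge a b c) → a ≢ b × a ≢ c × b ≢ c × E G a b c ≡ true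
    edge⁻ a b c t with Equivalence.to (T-∧ {apart₃ a b c}) t
    ... | p , e with apart₃⁻ a b c p
    ...   | ab , ac , bc = ab , ac , bc , Equivalence.to T-≡ e

    edge-apart : ∀ a b c → a ≢ b → a ≢ c → b ≢ c → edge a b c ≡ E G a b c
    edge-apart a b c ab ac bc
      rewrite Equivalence.to T-≡ (apart⁺ a b ab) | Equivalence.to T-≡ (apart⁺ a c ac) | Equivalence.to T-≡ (apart⁺ b c bc) = refl

  module _ (free : F32-free G) where

    loopless : F₃₂-Avoiding n
    loopless = record
      { edge       = edge
      ; edge-swap₁ = λ a b c → cong₂ _∧_ (apart₃-swap₁ a b c) (swap₁ G a b c)
      ; edge-swap₂ = λ a b c → cong₂ _∧_ (apart₃-swap₂ a b c) (swap₂ G a b c)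
      ; no-F₃₂     = λ u v x y z uvx uvy uvz xyz →
          let (u≢v , u≢x , v≢x , Euvx) = edge⁻ u v x uvx
              (_   , u≢y , v≢y , Euvy) = edge⁻ u v y uvy
              (_   , u≢z , v≢z , Euvz) = edge⁻ u v z uvz
              (x≢y , x≢z , y≢z , Exyz) = edge⁻ x y z xyz
              -- Every two of the five vertices lie together in one of the four edges.
              distinct : Unique (u ∷ v ∷ x ∷ y ∷ z ∷ [])
              distinct = (u≢v ∷ u≢x ∷ u≢y ∷ u≢z ∷ []) ∷ (v≢x ∷ v≢y ∷ v≢z ∷ []) ∷ (x≢y ∷ x≢z ∷ []) ∷ (y≢z ∷ []) ∷ [] ∷ []
          in free (lookup (u ∷ v ∷ x ∷ y ∷ z ∷ []) , lookup-injective distinct _ _ , Euvx , Euvy , Euvz , Exyz)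
      }

    -- An increasing quadruple has distinct vertices, so there the masked predicate agrees with `E`.
    24eK4≤ordered : 24 * eK4 G ≤ ordered-K₄s loopless
    24eK4≤ordered = begin
      24 * eK4 G
        ≡⟨ cong (24 *_) (trans (eK4-sum G) (sum₄-cong λ a b c d → ascending a b c d)) ⟩
      24 * sum₄ (λ a b c d → ⟦ asc₄ a b c d ⟧ * ⟦ K₄ edge a b c d ⟧)
        ≤⟨ 24∑asc≤∑ (λ a b c d → ⟦ K₄ edge a b c d ⟧)
             (λ a b c d → cong ⟦_⟧ (K₄-swap₁ a b c d))
             (λ a b c d → cong ⟦_⟧ (K₄-swap₂ a b c d))
             (λ a b c d → cong ⟦_⟧ (K₄-swap₃ a b c d)) ⟩
      ordered-K₄s loopless ∎
      where
      open ≤-Reasoning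
      open F₃₂-Avoiding loopless using (K₄-swap₁; K₄-swap₂; K₄-swap₃)
      ascending : ∀ a b c d → ⟦ asc₄ a b c d ⟧ * ⟦ isK4 G (a , b , c , d) ⟧ ≡ ⟦ asc₄ a b c d ⟧ * ⟦ K₄ edge a b c d ⟧
      ascending a b c d with asc₄ a b c d in eq
      ... | false = refl
      ... | true with asc₄⁻ a b c d (Equivalence.from T-≡ eq)
      ...   | a<b , b<c , c<d
        = cong (λ k → 1 * ⟦ k ⟧) (sym (cong₂ _∧_ (edge-apart a b c (distinct a<b) (distinct a<c) (distinct b<c))
                                  (cong₂ _∧_ (edge-apart a b d (distinct a<b) (distinct a<d) (distinct b<d))
                                  (cong₂ _∧_ (edge-apart a c d (distinct a<c) (distinct a<d) (distinct c<d))
                                             (edge-apart b c d (distinct b<c) (distinct b<d) (distinct c<d))))))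
        where
        distinct : ∀ {u v : Fin n} → u <ᶠ v → u ≢ v
        distinct u<v refl = <-irrefl refl u<v
        a<c : a <ᶠ c
        a<c = <-trans a<b b<c
        b<d : b <ᶠ d
        b<d = <-trans b<c c<d
        a<d : a <ᶠ d
        a<d = <-trans a<b b<d

    eK4-bound : 256 * eK4 G ≤ n * n * n * n
    eK4-bound = *-cancelˡ-≤ 3 (begin
      3 * (256 * eK4 G)             ≡⟨ regroup (eK4 G) ⟩
      32 * (24 * eK4 G)             ≤⟨ *-monoʳ-≤ 32 24eK4≤ordered ⟩
      32 * ordered-K₄s loopless     ≤⟨ ordered-K₄s-bound loopless ⟩
      3 * (n * n * n * n)           ∎)
      where
      open ≤-Reasoning
      regroup : ∀ m → 3 * (256 * m) ≡ 32 * (24 * m)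
      regroup = solve-∀

-- The balanced complete 4-partite 3-graph

partite : ∀ {n m} → (Fin n → Fin m) → Graph3 n
partite p = record
  { E     = λ a b c → apart₃ (p a) (p b) (p c)
  ; swap₁ = λ a b c → apart₃-swap₁ (p a) (p b) (p c)
  ; swap₂ = λ a b c → apart₃-swap₂ (p a) (p b) (p c)
  }

-- Every two vertices of F₃₂ lie in a common edge, so it would need five parts.
4-partite-free : ∀ {n} (p : Fin n → Fin 4) → F32-free (partite p)
4-partite-free p (f , _ , uvx , uvy , uvz , xyz) = contradiction (injective⇒≤ (lookup-injective five-parts _ _)) 1+n≰n
  where
  u = p (f v0)
  v = p (f v1)
  x = p (f v2)
  y = p (f v3)
  z = p (f v4)
  edge⁻ : ∀ a b c → apart₃ a b c ≡ true → a ≢ b × a ≢ c × b ≢ c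
  edge⁻ a b c e = apart₃⁻ a b c (Equivalence.from T-≡ e)
  five-parts : Unique (u ∷ v ∷ x ∷ y ∷ z ∷ [])
  five-parts with edge⁻ u v x uvx | edge⁻ u v y uvy | edge⁻ u v z uvz | edge⁻ x y z xyz
  ... | u≢v , u≢x , v≢x | _ , u≢y , v≢y | _ , u≢z , v≢z | x≢y , x≢z , y≢z =
    (u≢v ∷ u≢x ∷ u≢y ∷ u≢z ∷ []) ∷ (v≢x ∷ v≢y ∷ v≢z ∷ []) ∷ (x≢y ∷ x≢z ∷ []) ∷ (y≢z ∷ []) ∷ [] ∷ []

-- The half-open interval from l to l + q, built from `_<ᵇ_` so that the shifts in `block-size` hold
-- by computation.
block : ∀ {n} → ℕ → ℕ → Fin n → Bool
block l q a = not (toℕ a <ᵇ l) ∧ (toℕ a <ᵇ l + q)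

block⁻ : ∀ {n} l q (a : Fin n) → T (block l q a) → l ≤ toℕ a × toℕ a < l + q
block⁻ l q a t with Equivalence.to (T-∧ {not (toℕ a <ᵇ l)}) t
... | t₁ , t₂ = ≮⇒≥ (λ a<l → not-T _ t₁ (<⇒<ᵇ a<l)) , <ᵇ⇒< (toℕ a) (l + q) t₂
  where
  not-T : ∀ b → T (not b) → ¬ T b
  not-T false _ ()

block-size : ∀ {n} l q → l + q ≤ n → q ≤ sum {n} λ a → ⟦ block l q a ⟧
block-size         zero    zero    _       = z≤n
block-size {suc n} zero    (suc q) (s≤s p) = s≤s (block-size zero q p)
block-size {suc n} (suc l) q       (s≤s p) = block-size l q p

-- The last part takes every index from 3q on; for q = ⌊n/4⌋ it is larger than the others by at most
-- three.
part : ℕ → ℕ → Fin 4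
part q i with i <? q | i <? q + q | i <? q + q + q
... | yes _ | _     | _     = f0
... | no  _ | yes _ | _     = fs f0
... | no  _ | no  _ | yes _ = fs (fs f0)
... | no  _ | no  _ | no  _ = fs (fs (fs f0))

part-0 : ∀ q i → i < q → part q i ≡ f0
part-0 q i i<q with i <? q | i <? q + q | i <? q + q + q
... | yes _   | _ | _ = refl
... | no  i≮q | _ | _ = contradiction i<q i≮q

part-1 : ∀ q i → q ≤ i → i < q + q → part q i ≡ fs f0
part-1 q i q≤i i<2q with i <? q | i <? q + q | i <? q + q + q
... | yes i<q | _        | _ = contradiction q≤i (<⇒≱ i<q)
... | no  _   | yes _    | _ = refl
... | no  _   | no  i≮2q | _ = contradiction i<2q i≮2q

part-2 : ∀ q i → q + q ≤ i → i < q + q + q → part q i ≡ fs (fs f0)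
part-2 q i 2q≤i i<3q with i <? q | i <? q + q | i <? q + q + q
... | yes i<q | _        | _        = contradiction (≤-trans (m≤m+n q q) 2q≤i) (<⇒≱ i<q)
... | no  _   | yes i<2q | _        = contradiction 2q≤i (<⇒≱ i<2q)
... | no  _   | no  _    | yes _    = refl
... | no  _   | no  _    | no  i≮3q = contradiction i<3q i≮3q

part-3 : ∀ q i → q + q + q ≤ i → part q i ≡ fs (fs (fs f0))
part-3 q i 3q≤i with i <? q | i <? q + q | i <? q + q + q
... | yes i<q | _        | _        = contradiction (≤-trans (m≤m+n q q) (≤-trans (m≤m+n (q + q) q) 3q≤i)) (<⇒≱ i<q)
... | no  _   | yes i<2q | _        = contradiction (≤-trans (m≤m+n (q + q) q) 3q≤i) (<⇒≱ i<2q)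
... | no  _   | no  _    | yes i<3q = contradiction 3q≤i (<⇒≱ i<3q)
... | no  _   | no  _    | no  _    = refl

balanced : ∀ n → ℕ → Graph3 n
balanced n q = partite {n} (part q ∘ toℕ)

balanced-free : ∀ n q → F32-free (balanced n q)
balanced-free n q = 4-partite-free (part q ∘ toℕ)

sum₄-product : ∀ {n} (f g h k : Fin n → ℕ) →
  sum₄ (λ a b c d → f a * (g b * (h c * k d))) ≡ sum f * (sum g * (sum h * sum k))
sum₄-product f g h k = sym (trans (*-distribʳ-sum (sum g * (sum h * sum k)) f) (sum-cong-≗ λ a →
  trans (cong (f a *_) (trans (*-distribʳ-sum (sum h * sum k) g) (sum-cong-≗ λ b →
    trans (cong (g b *_) (sum-*-sum h k)) (sym (sum₂-*ˡ (g b) (λ c d → h c * k d))))))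
  (sym (sum₃-*ˡ (f a) (λ b c d → g b * (h c * k d))))))

⟦⟧-product≤ : ∀ p q r s {m} → (T p → T q → T r → T s → 1 ≤ m) → ⟦ p ⟧ * (⟦ q ⟧ * (⟦ r ⟧ * ⟦ s ⟧)) ≤ m
⟦⟧-product≤ false q     r     s     f = z≤n
⟦⟧-product≤ true  false r     s     f = z≤n
⟦⟧-product≤ true  true  false s     f = z≤n
⟦⟧-product≤ true  true  true  false f = z≤n
⟦⟧-product≤ true  true  true  true  f = f tt tt tt tt

-- One vertex from each of the first four intervals of length q gives an increasing quadruple
-- meeting all four parts, hence a K₄ counted by `eK4`. There are q⁴ such choices.
balanced-K₄s : ∀ n q → q + q + q + q ≤ n → q * (q * (q * q)) ≤ eK4 (balanced n q)
balanced-K₄s n q 4q≤n = begin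
  q * (q * (q * q))
    ≤⟨ *-mono-≤ (size 0 (≤-trans (m≤m+n q q) 2q≤n)) (*-mono-≤ (size q 2q≤n) (*-mono-≤ (size (q + q) 3q≤n) (size (q + q + q) 4q≤n))) ⟩
  sum (B 0) * (sum (B q) * (sum (B (q + q)) * sum (B (q + q + q))))
    ≡⟨ sum₄-product (B 0) (B q) (B (q + q)) (B (q + q + q)) ⟨
  sum₄ (λ a b c d → B 0 a * (B q b * (B (q + q) c * B (q + q + q) d)))
    ≤⟨ sum₄-mono (λ a b c d → ⟦⟧-product≤ (block 0 q a) (block q q b) (block (q + q) q c) (block (q + q + q) q d) (transversal a b c d)) ⟩
  sum₄ (λ a b c d → ⟦ asc₄ a b c d ⟧ * ⟦ isK4 (balanced n q) (a , b , c , d) ⟧)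
    ≡⟨ eK4-sum (balanced n q) ⟨
  eK4 (balanced n q) ∎
  where
  open ≤-Reasoning
  3q≤n : q + q + q ≤ n
  3q≤n = ≤-trans (m≤m+n (q + q + q) q) 4q≤n
  2q≤n : q + q ≤ n
  2q≤n = ≤-trans (m≤m+n (q + q) q) 3q≤n
  B : ℕ → Fin n → ℕ
  B l a = ⟦ block l q a ⟧
  size : ∀ l → l + q ≤ n → q ≤ sum (B l)
  size l = block-size l q
  transversal : ∀ a b c d → T (block 0 q a) → T (block q q b) → T (block (q + q) q c) → T (block (q + q + q) q d) →
                1 ≤ ⟦ asc₄ a b c d ⟧ * ⟦ isK4 (balanced n q) (a , b , c , d) ⟧
  transversal a b c d ta tb tc td with block⁻ 0 q a ta | block⁻ q q b tb | block⁻ (q + q) q c tc | block⁻ (q + q + q) q d td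
  ... | _ , a<q | q≤b , b<2q | 2q≤c , c<3q | 3q≤d , _
    rewrite part-0 q (toℕ a) a<q | part-1 q (toℕ b) q≤b b<2q | part-2 q (toℕ c) 2q≤c c<3q | part-3 q (toℕ d) 3q≤d
          | Equivalence.to T-≡ (asc₂⁺ a b (<-≤-trans a<q q≤b))
          | Equivalence.to T-≡ (asc₂⁺ b c (<-≤-trans b<2q 2q≤c))
          | Equivalence.to T-≡ (asc₂⁺ c d (<-≤-trans c<3q 3q≤d)) = ≤-refl

-- Existence of the maximum

allVecs : ∀ {A : Set} → List A → ∀ n → List (Vec A n)
allVecs xs zero    = [] ∷ []
allVecs xs (suc n) = cartesianProductWith _∷_ xs (allVecs xs n)

∈-allVecs : ∀ {A : Set} {xs : List A} → (∀ x → x ∈ xs) → ∀ {n} (v : Vec A n) → v ∈ allVecs xs n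
∈-allVecs all∈ []      = here refl
∈-allVecs all∈ (x ∷ v) = ∈-cartesianProductWith⁺ _∷_ (all∈ x) (∈-allVecs all∈ v)

-- Embeddings of F₃,₂ are searched for among vectors of length 5, which form an explicit finite
-- list.
F32-free? : ∀ {n} (G : Graph3 n) → Dec (F32-free G)
F32-free? {n} G = ¬? (map′ (λ x → found (satisfied x)) search (any? F32-at? (allVecs (allFin n) 5)))
  where
  F32-at : Vec (Fin n) 5 → Set
  F32-at w = Unique w ×
    (E G (lookup w v0) (lookup w v1) (lookup w v2) ≡ true) ×
    (E G (lookup w v0) (lookup w v1) (lookup w v3) ≡ true) ×
    (E G (lookup w v0) (lookup w v1) (lookup w v4) ≡ true) ×
    (E G (lookup w v2) (lookup w v3) (lookup w v4) ≡ true)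
  F32-at? : ∀ w → Dec (F32-at w)
  F32-at? w = allPairs? (λ a b → ¬? (a ≟ b)) w ×-dec (_ ≟ᵇ true) ×-dec (_ ≟ᵇ true) ×-dec (_ ≟ᵇ true) ×-dec (_ ≟ᵇ true)
  found : ∃ F32-at → ContainsF32 G
  found (w , distinct , edges) = lookup w , lookup-injective distinct _ _ , edges
  search : ContainsF32 G → _
  search (f , inj , edges) = lose (∈-allVecs ∈-allFin (tabulate f)) (tabulate⁺ inj , edges)

module _ {n : ℕ} where

  _≈E_ : Graph3 n → Graph3 n → Set
  G ≈E H = ∀ a b c → E G a b c ≡ E H a b c

  F32-free-resp : ∀ G H → G ≈E H → F32-free G → F32-free H
  F32-free-resp G H G≈H free (f , inj , e₁ , e₂ , e₃ , e₄) =
    free (f , inj , trans (G≈H _ _ _) e₁ , trans (G≈H _ _ _) e₂ , trans (G≈H _ _ _) e₃ , trans (G≈H _ _ _) e₄)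

  eK4-resp : ∀ G H → G ≈E H → eK4 G ≡ eK4 H
  eK4-resp G H G≈H = trans (eK4-sum G) (trans (sum₄-cong λ a b c d → cong (λ k → ⟦ asc₄ a b c d ⟧ * ⟦ k ⟧)
    (cong₂ _∧_ (G≈H a b c) (cong₂ _∧_ (G≈H a b d) (cong₂ _∧_ (G≈H a c d) (G≈H b c d))))) (sym (eK4-sum H)))

  -- The conjunction over all six orderings turns any table of Booleans into a 3-graph and preserves
  -- the values of a symmetric one, so every 3-graph is a `decode` up to `_≈E_`.
  symmetrize : (Fin n → Fin n → Fin n → Bool) → Graph3 n
  symmetrize g = record
    { E     = λ a b c → (g a b c ∧ g b a c) ∧ (g a c b ∧ g c a b) ∧ (g b c a ∧ g c b a)
    ; swap₁ = λ a b c → cong₂ _∧_ (∧-comm (g a b c) (g b a c)) (∧-comm (g a c b ∧ g c a b) (g b c a ∧ g c b a))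
    ; swap₂ = λ a b c → trans (cong (λ t → (g a b c ∧ g b a c) ∧ (g a c b ∧ g c a b) ∧ t) (∧-comm (g b c a) (g c b a)))
        (∧-exchange (g a b c ∧ g b a c) (g a c b ∧ g c a b) (g c b a ∧ g b c a))
    }
    where
    ∧-exchange : ∀ p q r → p ∧ q ∧ r ≡ q ∧ p ∧ r
    ∧-exchange p q r = trans (sym (∧-assoc p q r)) (trans (cong (_∧ r) (∧-comm p q)) (∧-assoc q p r))

  Code : Set
  Code = Vec (Vec (Vec Bool n) n) n

  codes : List Code
  codes = allVecs (allVecs (allVecs (true ∷ false ∷ []) n) n) n

  ∈-codes : ∀ code → code ∈ codes
  ∈-codes = ∈-allVecs (∈-allVecs (∈-allVecs λ { true → here refl ; false → there (here refl) }))

  decode : Code → Graph3 n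
  decode code = symmetrize λ a b c → lookup (lookup (lookup code a) b) c

  encode : Graph3 n → Code
  encode G = tabulate λ a → tabulate λ b → tabulate λ c → E G a b c

  lookup-encode : ∀ G a b c → lookup (lookup (lookup (encode G) a) b) c ≡ E G a b c
  lookup-encode G a b c
    rewrite lookup∘tabulate (λ a → tabulate λ b → tabulate λ c → E G a b c) a
          | lookup∘tabulate (λ b → tabulate λ c → E G a b c) b = lookup∘tabulate (E G a b) c

  decode-encode : ∀ G → decode (encode G) ≈E G
  decode-encode G a b c
    rewrite lookup-encode G a b c | lookup-encode G b a c | lookup-encode G a c b
          | lookup-encode G c a b | lookup-encode G b c a | lookup-encode G c b a
          | swap₁ G c b a | swap₂ G b c a | swap₁ G b a c | swap₁ G c a b | swap₂ G a c b
    = trans (cong₂ _∧_ (∧-idem e) (trans (cong₂ _∧_ (∧-idem e) (∧-idem e)) (∧-idem e))) (∧-idem e)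
    where
    e = E G a b c

  empty : Graph3 n
  empty = record { E = λ _ _ _ → false ; swap₁ = λ _ _ _ → refl ; swap₂ = λ _ _ _ → refl }

  empty-free : F32-free empty
  empty-free (_ , _ , () , _)

-- `ExDensityLimit` speaks only of those m with `IsEx n m`; this rules out that it holds vacuously.
-- The maximum is taken over the decoded F₃,₂-free graphs, with the empty graph as default, and
-- `eK4` and freeness respect `_≈E_`.
ex-exists : ∀ n → ∃ λ m → IsEx n m
ex-exists n = eK4 best , (best , argmax-all eK4 {P = F32-free} empty-free (all-filter F32-free? (map decode codes)) , refl) , maximal
  where
  candidates : List (Graph3 n)
  candidates = filter F32-free? (map decode codes)
  best : Graph3 n
  best = argmax eK4 empty candidates
  maximal : ∀ G → F32-free G → eK4 G ≤ eK4 best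
  maximal G free = ≤-trans (≤-reflexive (eK4-resp G G′ λ a b c → sym (decode-encode G a b c)))
    (All-lookup (f[xs]≤f[argmax] {f = eK4} empty candidates)
      (∈-filter⁺ F32-free? (∈-map⁺ decode (∈-codes (encode G)))
        (F32-free-resp G G′ (λ a b c → sym (decode-encode G a b c)) free)))
    where
    G′ = decode (encode G)

-- The limit

2*[n+2]C2 : ∀ n → 2 * ((2 + n) C 2) ≡ (2 + n) * (1 + n)
2*[n+2]C2 zero    = refl
2*[n+2]C2 (suc n) = begin-equality
  2 * ((3 + n) C 2)                        ≡⟨ cong (2 *_) (nCk+nC[k+1]≡[n+1]C[k+1] (2 + n) 1) ⟨
  2 * ((2 + n) C 1 + (2 + n) C 2)          ≡⟨ cong (λ t → 2 * (t + (2 + n) C 2)) (nC1≡n (2 + n)) ⟩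
  2 * (2 + n + (2 + n) C 2)                ≡⟨ *-distribˡ-+ 2 (2 + n) ((2 + n) C 2) ⟩
  2 * (2 + n) + 2 * ((2 + n) C 2)          ≡⟨ cong (λ t → 2 * (2 + n) + t) (2*[n+2]C2 n) ⟩
  2 * (2 + n) + (2 + n) * (1 + n)          ≡⟨ step n ⟩
  (3 + n) * (2 + n)                        ∎
  where
  open ≤-Reasoning
  step : ∀ n → 2 * (2 + n) + (2 + n) * (1 + n) ≡ (3 + n) * (2 + n)
  step = solve-∀

6*[n+3]C3 : ∀ n → 6 * ((3 + n) C 3) ≡ (3 + n) * (2 + n) * (1 + n)
6*[n+3]C3 zero    = refl
6*[n+3]C3 (suc n) = begin-equality
  6 * ((4 + n) C 3)                                     ≡⟨ cong (6 *_) (nCk+nC[k+1]≡[n+1]C[k+1] (3 + n) 2) ⟨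
  6 * ((3 + n) C 2 + (3 + n) C 3)                       ≡⟨ *-distribˡ-+ 6 ((3 + n) C 2) ((3 + n) C 3) ⟩
  6 * ((3 + n) C 2) + 6 * ((3 + n) C 3)                 ≡⟨ cong₂ _+_ (*-assoc 3 2 ((3 + n) C 2)) (6*[n+3]C3 n) ⟩
  3 * (2 * ((3 + n) C 2)) + (3 + n) * (2 + n) * (1 + n) ≡⟨ cong (λ t → 3 * t + (3 + n) * (2 + n) * (1 + n)) (2*[n+2]C2 (suc n)) ⟩
  3 * ((3 + n) * (2 + n)) + (3 + n) * (2 + n) * (1 + n) ≡⟨ step n ⟩
  (4 + n) * (3 + n) * (2 + n)                           ∎
  where
  open ≤-Reasoning
  step : ∀ n → 3 * ((3 + n) * (2 + n)) + (3 + n) * (2 + n) * (1 + n) ≡ (4 + n) * (3 + n) * (2 + n)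
  step = solve-∀

-- Induction by Pascal's rule. The offset 3 keeps all factors of the falling factorial free of
-- subtraction and starts from 3 C 4 = 0.
24*[n+3]C4 : ∀ n → 24 * ((3 + n) C 4) ≡ (3 + n) * (2 + n) * (1 + n) * n
24*[n+3]C4 zero    = refl
24*[n+3]C4 (suc n) = begin-equality
  24 * ((4 + n) C 4)                                            ≡⟨ cong (24 *_) (nCk+nC[k+1]≡[n+1]C[k+1] (3 + n) 3) ⟨
  24 * ((3 + n) C 3 + (3 + n) C 4)                              ≡⟨ *-distribˡ-+ 24 ((3 + n) C 3) ((3 + n) C 4) ⟩
  24 * ((3 + n) C 3) + 24 * ((3 + n) C 4)                       ≡⟨ cong₂ _+_ (*-assoc 4 6 ((3 + n) C 3)) (24*[n+3]C4 n) ⟩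
  4 * (6 * ((3 + n) C 3)) + (3 + n) * (2 + n) * (1 + n) * n     ≡⟨ cong (λ t → 4 * t + (3 + n) * (2 + n) * (1 + n) * n) (6*[n+3]C3 n) ⟩
  4 * ((3 + n) * (2 + n) * (1 + n)) + (3 + n) * (2 + n) * (1 + n) * n ≡⟨ step n ⟩
  (4 + n) * (3 + n) * (2 + n) * (1 + n)                         ∎
  where
  open ≤-Reasoning
  step : ∀ n → 4 * ((3 + n) * (2 + n) * (1 + n)) + (3 + n) * (2 + n) * (1 + n) * n ≡ (4 + n) * (3 + n) * (2 + n) * (1 + n)
  step = solve-∀

8∣x⊖y∣≤k : ∀ x y k → 8 * x ≤ 8 * y + k → 8 * y ≤ 8 * x + k → 8 * ℤ.∣ x ⊖ y ∣ ≤ k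
8∣x⊖y∣≤k x y k 8x≤ 8y≤ with ≤-total x y
... | inj₁ x≤y rewrite ℤ.∣⊖∣-≤ x≤y | *-distribˡ-∸ 8 y x = m≤n+o⇒m∸n≤o (8 * y) (8 * x) 8y≤
... | inj₂ y≤x rewrite ℤ.∣m⊖n∣≡∣n⊖m∣ x y | ℤ.∣⊖∣-≤ y≤x | *-distribˡ-∸ 8 x y = m≤n+o⇒m∸n≤o (8 * x) (8 * y) 8x≤

-- With s = 4⌊n/4⌋ and r = n - s ≤ 3, n⁴ - s⁴ = r(n³ + n²s + ns² + s³) ≤ 3·4n³.
n⁴≤256⌊n/4⌋⁴+12n³ : ∀ n → n * n * n * n ≤ 256 * (n div 4 * (n div 4 * (n div 4 * (n div 4)))) + 12 * (n * n * n)
n⁴≤256⌊n/4⌋⁴+12n³ n = begin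
  n * n * n * n
    ≡⟨ cong (λ t → t * t * t * t) n≡r+s ⟩
  (r + s) * (r + s) * (r + s) * (r + s)
    ≡⟨ difference r s ⟩
  s * s * s * s + r * ((r + s) * (r + s) * (r + s) + (r + s) * (r + s) * s + (r + s) * s * s + s * s * s)
    ≡⟨ cong (λ t → s * s * s * s + r * (t * t * t + t * t * s + t * s * s + s * s * s)) n≡r+s ⟨
  s * s * s * s + r * (n * n * n + n * n * s + n * s * s + s * s * s)
    ≤⟨ +-monoʳ-≤ (s * s * s * s) (*-mono-≤ r≤3 (+-mono-≤ (+-mono-≤ (+-monoʳ-≤ (n * n * n) (*-monoʳ-≤ (n * n) s≤n))
         (*-mono-≤ (*-monoʳ-≤ n s≤n) s≤n)) (*-mono-≤ (*-mono-≤ s≤n s≤n) s≤n))) ⟩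
  s * s * s * s + 3 * (n * n * n + n * n * n + n * n * n + n * n * n)
    ≡⟨ collect n (n div 4) ⟩
  256 * (n div 4 * (n div 4 * (n div 4 * (n div 4)))) + 12 * (n * n * n) ∎
  where
  open ≤-Reasoning
  r = n % 4
  s = n div 4 * 4
  n≡r+s : n ≡ r + s
  n≡r+s = m≡m%n+[m/n]*n n 4
  r≤3 : r ≤ 3
  r≤3 = ≤-pred (m%n<n n 4)
  s≤n : s ≤ n
  s≤n = ≤-trans (m≤n+m s r) (≤-reflexive (sym n≡r+s))
  difference : ∀ r s → (r + s) * (r + s) * (r + s) * (r + s)
    ≡ s * s * s * s + r * ((r + s) * (r + s) * (r + s) + (r + s) * (r + s) * s + (r + s) * s * s + s * s * s)
  difference = solve-∀
  collect : ∀ n q → q * 4 * (q * 4) * (q * 4) * (q * 4) + 3 * (n * n * n + n * n * n + n * n * n + n * n * n)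
                  ≡ 256 * (q * (q * (q * q))) + 12 * (n * n * n)
  collect = solve-∀

4⌊n/4⌋≤n : ∀ n → n div 4 + n div 4 + n div 4 + n div 4 ≤ n
4⌊n/4⌋≤n n = begin
  n div 4 + n div 4 + n div 4 + n div 4   ≡⟨ four (n div 4) ⟩
  n div 4 * 4                       ≤⟨ m≤n+m (n div 4 * 4) (n % 4) ⟩
  n % 4 + n div 4 * 4               ≡⟨ m≡m%n+[m/n]*n n 4 ⟨
  n                               ∎
  where
  open ≤-Reasoning
  four : ∀ q → q + q + q + q ≡ q * 4
  four = solve-∀

24*nC4≤n⁴ : ∀ n → 3 ≤ n → 24 * (n C 4) ≤ n * n * n * n
24*nC4≤n⁴ (suc (suc (suc n))) (s≤s (s≤s (s≤s _))) = begin
  24 * ((3 + n) C 4)                          ≡⟨ 24*[n+3]C4 n ⟩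
  (3 + n) * (2 + n) * (1 + n) * n             ≤⟨ *-mono-≤ (*-mono-≤ (*-monoʳ-≤ (3 + n) (n≤1+n (2 + n))) (m≤n+m (1 + n) 2)) (m≤n+m n 3) ⟩
  (3 + n) * (3 + n) * (3 + n) * (3 + n)       ∎
  where open ≤-Reasoning

n⁴≤24*nC4+6n³ : ∀ n → 3 ≤ n → n * n * n * n ≤ 24 * (n C 4) + 6 * (n * n * n)
n⁴≤24*nC4+6n³ (suc (suc (suc n))) (s≤s (s≤s (s≤s _))) = begin
  (3 + n) * (3 + n) * (3 + n) * (3 + n)
    -- The added term is 11N² - 6N at N = 3 + n, from N(N-1)(N-2)(N-3) = N⁴ - 6N³ + 11N² - 6N.
    ≤⟨ m≤m+n ((3 + n) * (3 + n) * (3 + n) * (3 + n)) (11 * (n * n) + 60 * n + 81) ⟩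
  (3 + n) * (3 + n) * (3 + n) * (3 + n) + (11 * (n * n) + 60 * n + 81)
    ≡⟨ expand n ⟩
  (3 + n) * (2 + n) * (1 + n) * n + 6 * ((3 + n) * (3 + n) * (3 + n))
    ≡⟨ cong (_+ 6 * ((3 + n) * (3 + n) * (3 + n))) (24*[n+3]C4 n) ⟨
  24 * ((3 + n) C 4) + 6 * ((3 + n) * (3 + n) * (3 + n)) ∎
  where
  open ≤-Reasoning
  expand : ∀ n → (3 + n) * (3 + n) * (3 + n) * (3 + n) + (11 * (n * n) + 60 * n + 81)
               ≡ (3 + n) * (2 + n) * (1 + n) * n + 6 * ((3 + n) * (3 + n) * (3 + n))
  expand = solve-∀

-- From n = 12 on the error 6n³ is at most half of n⁴.
n⁴≤48*nC4 : ∀ n → 12 ≤ n → n * n * n * n ≤ 48 * (n C 4)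
n⁴≤48*nC4 n 12≤n = +-cancelʳ-≤ (n * n * n * n) _ _ (begin
  n * n * n * n + n * n * n * n                 ≡⟨ two (n * n * n * n) ⟩
  2 * (n * n * n * n)                           ≤⟨ *-monoʳ-≤ 2 (n⁴≤24*nC4+6n³ n (≤-trans (m≤m+n 3 9) 12≤n)) ⟩
  2 * (24 * (n C 4) + 6 * (n * n * n))          ≡⟨ regroup (n C 4) (n * n * n) ⟩
  48 * (n C 4) + n * n * n * 12                 ≤⟨ +-monoʳ-≤ (48 * (n C 4)) (*-monoʳ-≤ (n * n * n) 12≤n) ⟩
  48 * (n C 4) + n * n * n * n                  ∎)
  where
  open ≤-Reasoning
  two : ∀ t → t + t ≡ 2 * t
  two = solve-∀
  regroup : ∀ c t → 2 * (24 * c + 6 * t) ≡ 48 * c + t * 12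
  regroup = solve-∀

-- The difference m/(n C 4) - 3/32 has numerator 32m - 3(n C 4). Multiplied by 8 it compares 256m
-- with 24(n C 4), each of which is n⁴ up to a cubic error.
ex-difference : ∀ n m → 3 ≤ n → IsEx n m → 8 * ℤ.∣ m * 32 ⊖ 3 * (n C 4) ∣ ≤ 12 * (n * n * n)
ex-difference n m 3≤n ((G , free , eK4≡m) , maximal) = 8∣x⊖y∣≤k (m * 32) (3 * (n C 4)) (12 * (n * n * n)) upper lower
  where
  open ≤-Reasoning
  regroupᵐ : ∀ m → 8 * (m * 32) ≡ 256 * m
  regroupᵐ = solve-∀
  regroupᶜ : ∀ c → 24 * c ≡ 8 * (3 * c)
  regroupᶜ = solve-∀
  256m≤n⁴ : 256 * m ≤ n * n * n * n
  256m≤n⁴ = subst (λ t → 256 * t ≤ n * n * n * n) eK4≡m (eK4-bound G free)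
  q⁴≤m : n div 4 * (n div 4 * (n div 4 * (n div 4))) ≤ m
  q⁴≤m = ≤-trans (balanced-K₄s n (n div 4) (4⌊n/4⌋≤n n)) (maximal (balanced n (n div 4)) (balanced-free n (n div 4)))
  upper : 8 * (m * 32) ≤ 8 * (3 * (n C 4)) + 12 * (n * n * n)
  upper = begin
    8 * (m * 32)                                ≡⟨ regroupᵐ m ⟩
    256 * m                                     ≤⟨ 256m≤n⁴ ⟩
    n * n * n * n                               ≤⟨ n⁴≤24*nC4+6n³ n 3≤n ⟩
    24 * (n C 4) + 6 * (n * n * n)              ≤⟨ +-monoʳ-≤ (24 * (n C 4)) (*-monoˡ-≤ (n * n * n) (m≤m+n 6 6)) ⟩
    24 * (n C 4) + 12 * (n * n * n)             ≡⟨ cong (_+ 12 * (n * n * n)) (regroupᶜ (n C 4)) ⟩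
    8 * (3 * (n C 4)) + 12 * (n * n * n)        ∎
  lower : 8 * (3 * (n C 4)) ≤ 8 * (m * 32) + 12 * (n * n * n)
  lower = begin
    8 * (3 * (n C 4))                           ≡⟨ regroupᶜ (n C 4) ⟨
    24 * (n C 4)                                ≤⟨ 24*nC4≤n⁴ n 3≤n ⟩
    n * n * n * n                               ≤⟨ n⁴≤256⌊n/4⌋⁴+12n³ n ⟩
    256 * (n div 4 * (n div 4 * (n div 4 * (n div 4)))) + 12 * (n * n * n) ≤⟨ +-monoˡ-≤ (12 * (n * n * n)) (*-monoʳ-≤ 256 q⁴≤m) ⟩
    256 * m + 12 * (n * n * n)                  ≡⟨ cong (_+ 12 * (n * n * n)) (regroupᵐ m) ⟨
    8 * (m * 32) + 12 * (n * n * n)             ∎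

relative-error : ∀ δ c n e → 8 * δ ≤ 12 * (n * n * n) → n * n * n * n ≤ 48 * c → .⦃ NonZero c ⦄ →
                 3 * suc e ≤ n → δ * suc e < c * 32
relative-error δ c n e 8δ≤12n³ n⁴≤48c 3e≤n = *-cancelˡ-< 8 (δ * suc e) (c * 32) (begin-strict
  8 * (δ * suc e)                       ≡⟨ *-assoc 8 δ (suc e) ⟨
  8 * δ * suc e                         ≤⟨ *-monoˡ-≤ (suc e) 8δ≤12n³ ⟩
  12 * (n * n * n) * suc e              ≡⟨ regroup₁ (n * n * n) (suc e) ⟩
  n * n * n * (4 * (3 * suc e))         ≤⟨ *-monoʳ-≤ (n * n * n) (*-monoʳ-≤ 4 3e≤n) ⟩
  n * n * n * (4 * n)                   ≡⟨ regroup₂ n ⟩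
  4 * (n * n * n * n)                   ≤⟨ *-monoʳ-≤ 4 n⁴≤48c ⟩
  4 * (48 * c)                          ≡⟨ regroup₃ c ⟩
  -- Strictness comes from this slack, as c is nonzero.
  c * 192                               <⟨ *-monoʳ-< c {192} {256} (<ᵇ⇒< 192 256 tt) ⟩
  c * 256                               ≡⟨ regroup₄ c ⟩
  8 * (c * 32)                          ∎)
  where
  open ≤-Reasoning
  regroup₁ : ∀ t e → 12 * t * e ≡ t * (4 * (3 * e))
  regroup₁ = solve-∀
  regroup₂ : ∀ n → n * n * n * (4 * n) ≡ 4 * (n * n * n * n)
  regroup₂ = solve-∀
  regroup₃ : ∀ c → 4 * (48 * c) ≡ c * 192
  regroup₃ = solve-∀
  regroup₄ : ∀ c → c * 256 ≡ 8 * (c * 32)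
  regroup₄ = solve-∀

-- In the threshold, 12 serves `n⁴≤48*nC4` and 3(e + 1) serves `relative-error`.
ex-close : ∀ n m e → 12 + 3 * suc e ≤ n → IsEx n m → ℤ.∣ m * 32 ⊖ 3 * (n C 4) ∣ * suc e < (n C 4) * 32
ex-close n m e N≤n ex =
  relative-error ℤ.∣ m * 32 ⊖ 3 * (n C 4) ∣ (n C 4) n e (ex-difference n m 3≤n ex) n⁴≤ ⦃ nC4≢0 (n C 4) n⁴≤ ⦄ (m+n≤o⇒n≤o 12 N≤n)
  where
  12≤n : 12 ≤ n
  12≤n = m+n≤o⇒m≤o 12 N≤n
  3≤n : 3 ≤ n
  3≤n = ≤-trans (m≤m+n 3 9) 12≤n
  0<n : 0 < n
  0<n = ≤-trans (s≤s z≤n) 12≤n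
  n⁴≤ : n * n * n * n ≤ 48 * (n C 4)
  n⁴≤ = n⁴≤48*nC4 n 12≤n
  nC4≢0 : ∀ c → n * n * n * n ≤ 48 * c → NonZero c
  nC4≢0 (suc _) _    = _
  nC4≢0 zero    n⁴≤0 = contradiction (≤-trans (*-mono-≤ (*-mono-≤ (*-mono-≤ 0<n 0<n) 0<n) 0<n) n⁴≤0) λ ()

-- Passage to the rationals.

∣-∣-homo : ∀ p q {p′ q′} → toℚᵘ p ℚᵘ.≃ p′ → toℚᵘ q ℚᵘ.≃ q′ → toℚᵘ ℚ.∣ p ℚ.- q ∣ ℚᵘ.≃ ℚᵘ.∣ p′ ℚᵘ.- q′ ∣
∣-∣-homo p q {p′} {q′} p≃p′ q≃q′ = begin
  toℚᵘ ℚ.∣ p ℚ.- q ∣                ≈⟨ ℚ.toℚᵘ-homo-∣-∣ (p ℚ.- q) ⟩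
  ℚᵘ.∣ toℚᵘ (p ℚ.- q) ∣             ≈⟨ ℚᵘ.∣-∣-cong (ℚ.toℚᵘ-homo-+ p (ℚ.- q)) ⟩
  ℚᵘ.∣ toℚᵘ p ℚᵘ.+ toℚᵘ (ℚ.- q) ∣   ≈⟨ ℚᵘ.∣-∣-cong (ℚᵘ.+-cong p≃p′ (ℚᵘ.≃-trans (ℚ.toℚᵘ-homo‿- q) (ℚᵘ.-‿cong q≃q′))) ⟩
  ℚᵘ.∣ p′ ℚᵘ.- q′ ∣                 ∎
  where open SetoidReasoning ℚᵘ.≃-setoid

-- Cross-multiplication, carried out on unnormalised fractions, where numerator and denominator of
-- the difference are explicit.
∣m/d-a/b∣<ε : ∀ m d a b ε {num den} → toℚᵘ ε ≡ mkℚᵘ (+ suc num) den →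
  ℤ.∣ m * suc b ⊖ a * suc d ∣ * suc den < suc num * (suc d * suc b) →
  ℚ.∣ (+ m) ℚ./ suc d ℚ.- (+ a) ℚ./ suc b ∣ ℚ.< ε
∣m/d-a/b∣<ε m d a b ε {num} {den} ε≡ bound = ℚ.toℚᵘ-cancel-<
  (ℚᵘ.<-respˡ-≃ (ℚᵘ.≃-sym (∣-∣-homo p q (ℚ.toℚᵘ-fromℚᵘ (mkℚᵘ (+ m) d)) (ℚ.toℚᵘ-fromℚᵘ (mkℚᵘ (+ a) b))))
    (subst (ℚᵘ.∣ mkℚᵘ (+ m) d ℚᵘ.- mkℚᵘ (+ a) b ∣ ℚᵘ.<_) (sym ε≡) (ℚᵘ.*<* cross)))
  where
  p = (+ m) ℚ./ suc d
  q = (+ a) ℚ./ suc b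
  numerator : (+ m) ℤ.* (+ suc b) ℤ.+ (ℤ.- (+ a)) ℤ.* (+ suc d) ≡ m * suc b ⊖ a * suc d
  numerator = trans (cong₂ ℤ._+_ (sym (ℤ.pos-* m (suc b)))
    (trans (sym (ℤ.neg-distribˡ-* (+ a) (+ suc d))) (cong (λ t → ℤ.- t) (sym (ℤ.pos-* a (suc d))))))
    (ℤ.m-n≡m⊖n (m * suc b) (a * suc d))
  cross : (+ ℤ.∣ (+ m) ℤ.* (+ suc b) ℤ.+ (ℤ.- (+ a)) ℤ.* (+ suc d) ∣) ℤ.* (+ suc den) ℤ.< (+ suc num) ℤ.* (+ (suc d * suc b))
  cross = subst₂ ℤ._<_
    (trans (ℤ.pos-* ℤ.∣ m * suc b ⊖ a * suc d ∣ (suc den)) (cong (λ t → (+ ℤ.∣ t ∣) ℤ.* (+ suc den)) (sym numerator)))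
    (ℤ.pos-* (suc num) (suc d * suc b)) (ℤ.+<+ bound)

density-nonzero : ∀ n m {d} → n C 4 ≡ suc d → density n m ≡ (+ m) ℚ./ suc d
density-nonzero n m eq rewrite eq = refl

density-limit : ExDensityLimit ((+ 3) ℚ./ 32)
-- As ε is at least 1/(den + 1), a threshold depending on `den` alone suffices.
density-limit ε@(mkℚ (+ suc num) den _) ε>0 = 12 + 3 * suc den , λ n n≥N m ex → close n m (n C 4) refl (ex-close n m den n≥N ex)
  where
  -- The binomial is generalised to `c`, so that it can be matched as a successor, as `density`
  -- does.
  close : ∀ n m c → n C 4 ≡ c → ℤ.∣ m * 32 ⊖ 3 * c ∣ * suc den < c * 32 → ℚ.∣ density n m ℚ.- (+ 3) ℚ./ 32 ∣ ℚ.< ε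
  close n m (suc d) eq bound = subst (λ t → ℚ.∣ t ℚ.- (+ 3) ℚ./ 32 ∣ ℚ.< ε) (sym (density-nonzero n m eq))
    -- The argument 31 stands for the denominator 32, stored as its predecessor.
    (∣m/d-a/b∣<ε m d 3 31 ε refl (<-≤-trans bound (m≤n*m (suc d * 32) (suc num))))

theorem2p23 : ((n : ℕ) → ∃ λ m → IsEx n m) × ExDensityLimit ((+ 3) / 32)
theorem2p23 = ex-exists , density-limit
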